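{- Let $h\ge 1$ be an integer, let $r$ be a positive integer with $r>\log_2 h$, and let $e$ be a primitive element of $\mathbb{F}_{2^r}$. Let $\Gamma$ and $\Gamma'$ be finite multi-graphs, with vertex sets $V$ and $V'$ respectively, whose edges have weights belonging to $\{1,\ldots,h\}$, and assume that $h\le \frac12|V|(|V|-1)$ and $h\le \frac12|V'|(|V'|-1)$. Let $\mathrm{G}(\Gamma)$ and $\mathrm{G}(\Gamma')$ be the matrices over $\mathbb{F}_{2^r}$ associated with $\Gamma$ and $\Gamma'$ (both constructed with the same $h$, $r$ and $e$) as defined in the context. Then $\Gamma$ and $\Gamma'$ are isomorphic as multi-graphs if and only if the additive codes over $\mathbb{F}_{2^r}$ generated by $\mathrm{G}(\Gamma)$ and $\mathrm{G}(\Gamma')$ (that is, their $\mathbb{F}_2$-row spans) are equivalent.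
   Context: **Multi-graphs.** A multi-graph (with weights in $\{1,\ldots,h\}$) is a finite simple graph (undirected, no loops) in which each edge is assigned a weight from $\{1,\ldots,h\}$; an edge of weight $w$ joining $u$ and $v$ is interpreted as $w$ parallel edges joining $u$ and $v$. Two multi-graphs are isomorphic if there is a bijection between their vertex sets which induces a bijection between their edge sets mapping edges of weight $w$ to edges of weight $w$, for every $w$. **Additive codes and equivalence.** Let $F$ be a finite field of characteristic $2$. An additive code of length $N$ over $F$ is an $\mathbb{F}_2$-linear subspace $C$ of $F^N$ (equivalently, a nonempty subset closed under addition). The additive code generated by a matrix over $F$ is the $\mathbb{F}_2$-span of its rows. Two additive codes $C, C'$ over $F$ are equivalent if they have the same length $N$ and there are a permutation $\pi$ of $\{1,\ldots,N\}$ and, for each $i\in\{1,\ldots,N\}$, a permutation (an arbitrary bijection, not assumed additive) $\sigma_i$ of the set $F$ such that $$C'=\{(\sigma_1(c_{\pi(1)}),\ldots,\sigma_N(c_{\pi(N)})) : (c_1,\ldots,c_N)\in C\}.$$ **The matrix $\mathrm{G}(\Gamma)$.** Let $\Gamma$ be a multi-graph with vertex set $V$ and edge set $E$, with weights in $\{1,\ldots,h\}$. For $i\in\{1,\ldots,h\}$ let $E_i\subseteq E$ be the set of edges of weight at least $i$ (so $E_1=E$). Order the edges so that their weights are non-decreasing (so that, for each $i$, the edges of $E_i$ come last). Let $\mathrm{D}_i$ be the $|E_i|\times|E_i|$ diagonal matrix over $\mathbb{F}_{2^r}$, indexed by the edges of $E_i$ in this order, whose diagonal entry in the row of an edge of weight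 $j$ is $e^{j-1}$. Let $O_i$ be the $(|E|-|E_i|)\times|E_i|$ zero matrix. Let $A$ be the $|E|\times|V|$ matrix over $\mathbb{F}_{2^r}$ with rows indexed by the edges and columns indexed by the vertices, whose (edge, vertex) entry is $e^{j-1}$ if the edge is incident with the vertex and has weight $j$, and is $0$ if the edge is not incident with the vertex. Put $$N=(h+2)|E_1|+|E_2|+\cdots+|E_h|+|V|$$ and let $\mathrm{G}(\Gamma)$ be the $|E|\times N$ matrix $$ \mathrm{G}(\Gamma)=\left( \underbrace{\mathrm{D}_1 \ | \ \mathrm{D}_1 \ | \ \cdots \ | \ \mathrm{D}_1}_{h+2} \ | \ \begin{array}{c} O_2 \\ \mathrm{D}_2 \end{array} \ | \ \begin{array}{c} O_3 \\ \mathrm{D}_3 \end{array} \ | \ \cdots \ | \ \begin{array}{c} O_h \\ \mathrm{D}_h \end{array} \ | \ A \right). $$ (Blocks with $E_i=\emptyset$ have no columns.) -}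

module Defs where

open import Algebra.Bundles using (CommutativeRing)
open import Algebra.Structures using (IsCommutativeRing)
import Algebra.Properties.CommutativeMonoid.Sum as Sum
import Algebra.Properties.Ring as RingProperties
import Algebra.Properties.Semiring.Exp as Exp
import Algebra.Properties.Semiring.Mult as Mult
open import Data.Bool.Base using (Bool; true; false; if_then_else_; _∨_; _xor_)
open import Data.Fin.Base as Fin using (Fin; toℕ)
open import Data.Fin.Permutation using (Permutation; permutation; _⟨$⟩ʳ_)
import Data.Fin.Properties as Fin
open import Data.List.Base using (List; []; _∷_; length; filter; allFin; lookup; map; upTo)
open import Data.List.Properties using (length-filter; length-tabulate)
open import Data.Maybe.Base using (Maybe; just; nothing)
open import Data.Nat.Base as ℕ using (ℕ; zero; suc; _∸_; _≤_)
open import Data.Nat.ListAction using (sum)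
import Data.Nat.Properties as ℕ
open import Data.Product.Base using (∃-syntax; _×_; _,_)
open import Data.Vec.Functional using (Vector; _++_; concat; replicate)
open import Function.Bundles using (_↔_; _⇔_; Inverse)
open import Function.Properties.Inverse using (↔-sym; Inverse⇒Injection)
open import Level using (0ℓ)
open import Relation.Binary.Definitions using (DecidableEquality)
open import Relation.Binary.PropositionalEquality
open import Relation.Nullary using (yes; no; does; contradiction)

------------------------------------------------------------------------
-- Finite fields

-- A field with exactly q elements.  𝔽_{2^r} is any inhabitant of
-- FiniteField (2 ^ r); it is unique up to isomorphism.
record FiniteField (q : ℕ) : Set₁ where
  infixl 7 _*_
  infixl 6 _+_
  field
    Carrier           : Set
    _+_ _*_           : Carrier → Carrier → Carrier
    -_                : Carrier → Carrier
    0# 1#             : Carrier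
    isCommutativeRing : IsCommutativeRing _≡_ _+_ _*_ -_ 0# 1#
    0≢1               : 0# ≢ 1#
    inverse           : ∀ x → x ≢ 0# → ∃[ y ] x * y ≡ 1#
    enumeration       : Fin q ↔ Carrier

  commutativeRing : CommutativeRing 0ℓ 0ℓ
  commutativeRing = record { isCommutativeRing = isCommutativeRing }

  open CommutativeRing commutativeRing public
    using (ring; semiring; +-commutativeMonoid; +-identityˡ; +-identityʳ;
           +-assoc; -‿inverseʳ; *-identityˡ; *-identityʳ; *-assoc; *-comm;
           distribˡ; distribʳ; zeroˡ; zeroʳ)

  open Exp semiring public using (_^_)

  -- e generates the multiplicative group.  Natural exponents suffice since the
  -- group is finite; e ≢ 0# is needed because 0# ^ 0 = 1# when q = 2.
  IsPrimitive : Carrier → Set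
  IsPrimitive e = e ≢ 0# × (∀ x → x ≢ 0# → ∃[ k ] x ≡ e ^ k)

  infix 4 _≟_
  _≟_ : DecidableEquality Carrier
  _≟_ = Fin.inj⇒≟ (Inverse⇒Injection (↔-sym enumeration))

module _ (r : ℕ) (F : FiniteField (2 ℕ.^ r)) where
  open FiniteField F
  open Sum +-commutativeMonoid using (∑-distrib-+; sum-permute; sum-replicate; sum-cong-≗)
    renaming (sum to ∑)
  open Mult semiring using (×1-homo-*) renaming (_×_ to _·_)
  open RingProperties ring using (+-cancelˡ)
  open ≡-Reasoning

  private
    q : ℕ
    q = 2 ℕ.^ r

    elem : Fin q → Carrier
    elem = Inverse.to enumeration

    index : Carrier → Fin q
    index = Inverse.from enumeration

    elem-index : ∀ x → elem (index x) ≡ x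
    elem-index = Inverse.strictlyInverseˡ enumeration

    index-elem : ∀ i → index (elem i) ≡ i
    index-elem = Inverse.strictlyInverseʳ enumeration

    x+y-y : ∀ x y z → y + z ≡ 0# → (x + y) + z ≡ x
    x+y-y x y z p = begin
      (x + y) + z  ≡⟨ +-assoc x y z ⟩
      x + (y + z)  ≡⟨ cong (x +_) p ⟩
      x + 0#       ≡⟨ +-identityʳ x ⟩
      x            ∎

    shift : Carrier → Fin q → Fin q
    shift y i = index (elem i + y)

    shift-inverse : ∀ y z → y + z ≡ 0# → ∀ i → shift z (shift y i) ≡ i
    shift-inverse y z p i = begin
      index (elem (index (elem i + y)) + z)  ≡⟨ cong (λ x → index (x + z)) (elem-index _) ⟩
      index ((elem i + y) + z)               ≡⟨ cong index (x+y-y (elem i) y z p) ⟩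
      index (elem i)                         ≡⟨ index-elem i ⟩
      i                                      ∎

    -1+1 : (- 1#) + 1# ≡ 0#
    -1+1 = CommutativeRing.-‿inverseˡ commutativeRing 1#

    translation : Permutation q q
    translation = permutation (shift 1#) (shift (- 1#))
      (shift-inverse (- 1#) 1# -1+1)
      (shift-inverse 1# (- 1#) (-‿inverseʳ 1#))

    q·1≡0 : q · 1# ≡ 0#
    q·1≡0 = +-cancelˡ (∑ elem) _ _ (begin
      ∑ elem + q · 1#                ≡⟨ cong (∑ elem +_) (sum-replicate q) ⟨
      ∑ elem + ∑ (replicate q 1#)    ≡⟨ ∑-distrib-+ elem (replicate q 1#) ⟨
      ∑ (λ i → elem i + 1#)          ≡⟨ sum-cong-≗ (λ i → elem-index (elem i + 1#)) ⟨
      ∑ (λ i → elem (shift 1# i))    ≡⟨ sum-permute elem translation ⟨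
      ∑ elem                         ≡⟨ +-identityʳ _ ⟨
      ∑ elem + 0#                    ∎)

    x*y≡0⇒y≡0 : ∀ x y → x ≢ 0# → x * y ≡ 0# → y ≡ 0#
    x*y≡0⇒y≡0 x y x≢0 xy≡0 with z , xz≡1 ← inverse x x≢0 = begin
      y            ≡⟨ *-identityˡ y ⟨
      1# * y       ≡⟨ cong (_* y) xz≡1 ⟨
      x * z * y    ≡⟨ cong (_* y) (*-comm x z) ⟩
      z * x * y    ≡⟨ *-assoc z x y ⟩
      z * (x * y)  ≡⟨ cong (z *_) xy≡0 ⟩
      z * 0#       ≡⟨ zeroʳ z ⟩
      0#           ∎

    2^k·1≡0⇒2·1≡0 : ∀ k → (2 ℕ.^ k) · 1# ≡ 0# → 2 · 1# ≡ 0#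
    2^k·1≡0⇒2·1≡0 zero    p = contradiction (trans (sym p) (+-identityʳ 1#)) 0≢1
    2^k·1≡0⇒2·1≡0 (suc k) p with 2 · 1# ≟ 0#
    ... | yes 2≡0 = 2≡0
    ... | no  2≢0 = 2^k·1≡0⇒2·1≡0 k
      (x*y≡0⇒y≡0 _ _ 2≢0 (trans (sym (×1-homo-* 2 (2 ℕ.^ k))) p))

  characteristic-2 : ∀ x → x + x ≡ 0#
  characteristic-2 x = begin
    x + x              ≡⟨ cong₂ _+_ (*-identityˡ x) (*-identityˡ x) ⟨
    1# * x + 1# * x    ≡⟨ distribʳ x 1# 1# ⟨
    (1# + 1#) * x      ≡⟨ cong (λ y → (1# + y) * x) (+-identityʳ 1#) ⟨
    (2 · 1#) * x       ≡⟨ cong (_* x) (2^k·1≡0⇒2·1≡0 r q·1≡0) ⟩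
    0# * x             ≡⟨ zeroˡ x ⟩
    0#                 ∎

------------------------------------------------------------------------
-- Additive codes

Matrix : Set → ℕ → ℕ → Set
Matrix A m n = Fin m → Fin n → A

module _ (r : ℕ) (F : FiniteField (2 ℕ.^ r)) where
  open FiniteField F
  open Sum +-commutativeMonoid using (∑-distrib-+; sum-cong-≗; sum-replicate-zero)
    renaming (sum to ∑)

  -- An 𝔽₂-linear subspace of F^N.  Words are functions, so the subset has to be
  -- closed under pointwise equality.
  record AdditiveCode (N : ℕ) : Set₁ where
    field
      Member   : Vector Carrier N → Set
      respects : ∀ {c d} → c ≗ d → Member c → Member d
      zero∈    : Member (λ _ → 0#)
      +-closed : ∀ {c d} → Member c → Member d → Member (λ i → c i + d i)

  open AdditiveCode

  -- 𝔽₂ is Bool with _xor_ as addition.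
  infixr 7 _•_
  _•_ : Bool → Carrier → Carrier
  b • x = if b then x else 0#

  combination : ∀ {m N} → Vector Bool m → Matrix Carrier m N → Vector Carrier N
  combination a M i = ∑ (λ j → a j • M j i)

  private
    •-distribʳ-xor : ∀ a b x → (a xor b) • x ≡ a • x + b • x
    •-distribʳ-xor false b     x = sym (+-identityˡ (b • x))
    •-distribʳ-xor true  false x = sym (+-identityʳ x)
    •-distribʳ-xor true  true  x = sym (characteristic-2 r F x)

    combination-xor : ∀ {m N} (a b : Vector Bool m) (M : Matrix Carrier m N) i →
      combination (λ j → a j xor b j) M i ≡ combination a M i + combination b M i
    combination-xor a b M i = trans
      (sum-cong-≗ (λ j → •-distribʳ-xor (a j) (b j) (M j i)))
      (∑-distrib-+ (λ j → a j • M j i) (λ j → b j • M j i))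

  rowSpan : ∀ {m N} → Matrix Carrier m N → AdditiveCode N
  rowSpan {m} M = record
    { Member   = λ c → ∃[ a ] c ≗ combination a M
    ; respects = λ c≗d (a , p) → a , λ i → trans (sym (c≗d i)) (p i)
    ; zero∈    = (λ _ → false) , λ _ → sym (sum-replicate-zero m)
    ; +-closed = λ (a , p) (b , p′) → (λ j → a j xor b j) ,
        λ i → trans (cong₂ _+_ (p i) (p′ i)) (sym (combination-xor a b M i))
    }

  record Equivalent {N N′ : ℕ} (C : AdditiveCode N) (C′ : AdditiveCode N′) : Set where
    field
      sameLength : N ≡ N′
      π          : Permutation N′ N
      σ          : Fin N′ → Carrier ↔ Carrier
      image      : ∀ c′ → Member C′ c′ ⇔
                     (∃[ c ] Member C c × (∀ i → c′ i ≡ Inverse.to (σ i) (c (π ⟨$⟩ʳ i))))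

------------------------------------------------------------------------
-- Multi-graphs

-- Vertex set Fin n.  weight u v is nothing if u and v are not adjacent, and
-- just k if they are joined by an edge of weight toℕ k + 1.
record MultiGraph (h n : ℕ) : Set where
  field
    weight    : Fin n → Fin n → Maybe (Fin h)
    symmetric : ∀ u v → weight u v ≡ weight v u
    loopless  : ∀ v → weight v v ≡ nothing

infix 4 _≅_
record _≅_ {h n n′ : ℕ} (Γ : MultiGraph h n) (Γ′ : MultiGraph h n′) : Set where
  private
    module Γ  = MultiGraph Γ
    module Γ′ = MultiGraph Γ′
  field
    vertices : Fin n ↔ Fin n′
    weights  : ∀ u v → Γ′.weight (Inverse.to vertices u) (Inverse.to vertices v) ≡ Γ.weight u v

-- The undirected edge joining u and v is represented once, by its endpoints in
-- increasing order.
record Edge {h n : ℕ} (Γ : MultiGraph h n) : Set where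
  open MultiGraph Γ
  field
    u v    : Fin n
    u<v    : u Fin.< v
    k      : Fin h
    joined : weight u v ≡ just k

  edgeWeight : ℕ
  edgeWeight = suc (toℕ k)

  incident : Fin n → Bool
  incident w = does (w Fin.≟ u) ∨ does (w Fin.≟ v)

open Edge using (edgeWeight; incident)

-- An enumeration of the m edges by non-decreasing weight.
record EdgeOrdering {h n : ℕ} (Γ : MultiGraph h n) (m : ℕ) : Set where
  field
    bijection : Fin m ↔ Edge Γ

  edge : Fin m → Edge Γ
  edge = Inverse.to bijection

  field
    monotone : ∀ i j → i Fin.≤ j → edgeWeight (edge i) ≤ edgeWeight (edge j)

------------------------------------------------------------------------
-- The matrix G(Γ)

2⋯_ : ℕ → List ℕ
2⋯ h = map (2 ℕ.+_) (upTo (h ∸ 1))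

module _ {h n m : ℕ} {Γ : MultiGraph h n} (o : EdgeOrdering Γ m) where
  open EdgeOrdering o

  -- E i lists, in order, the positions of the edges of weight at least i.
  E : ℕ → List (Fin m)
  E i = filter (λ j → i ℕ.≤? edgeWeight (edge j)) (allFin m)

  ∣E_∣ : ℕ → ℕ
  ∣E i ∣ = length (E i)

  ∣E∣≤m : ∀ i → ∣E i ∣ ≤ m
  ∣E∣≤m i = ℕ.≤-trans (length-filter _ (allFin m)) (ℕ.≤-reflexive (length-tabulate _))

  codeLength : ℕ
  codeLength = (h ℕ.+ 2) ℕ.* ∣E 1 ∣ ℕ.+ (sum (map ∣E_∣ (2⋯ h)) ℕ.+ n)

  module _ {q : ℕ} (F : FiniteField q) (e : FiniteField.Carrier F) where
    open FiniteField F

    entry : Fin m → Carrier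
    entry j = e ^ (edgeWeight (edge j) ∸ 1)

    D : ∀ i → Matrix Carrier ∣E i ∣ ∣E i ∣
    D i k l = if does (k Fin.≟ l) then entry (lookup (E i) k) else 0#

    O : ∀ i → Matrix Carrier (m ∸ ∣E i ∣) ∣E i ∣
    O i _ _ = 0#

    -- O i on top of D i; O 1 has no rows.
    block : ∀ i → Matrix Carrier m ∣E i ∣
    block i j = (O i ++ D i) (Fin.cast (sym (ℕ.m∸n+n≡m (∣E∣≤m i))) j)

    blocks : (is : List ℕ) → Matrix Carrier m (sum (map ∣E_∣ is))
    blocks []       j ()
    blocks (i ∷ is) j = block i j ++ blocks is j

    A : Matrix Carrier m n
    A j w = if incident (edge j) w then entry j else 0#

    G : Matrix Carrier m codeLength
    G j = concat (replicate (h ℕ.+ 2) (block 1 j)) ++ (blocks (2⋯ h) j ++ A j)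

{-# OPTIONS --safe #-}

-- Every row of G(Γ) has weight h + 3 + w, where w is the weight of its edge, and
-- w ≤ h; a sum of at least two rows already has weight at least 2(h + 2) on the
-- h + 2 copies of D₁.  So the rows are exactly the nonzero words of weight at most
-- 2h + 3.  An equivalence of codes, followed by the translation by the image of
-- the zero word, preserves supports up to a permutation of the coordinates; hence
-- it matches the rows of the two matrices, preserving edge weights, and it matches
-- the multisets of column supports.  Edge weights determine how many columns of
-- the blocks D have a given support, so after cancelling these the columns of the
-- two incidence matrices A are matched, which is a bijection of the vertices.
module Submission where

open import Defs
open import Algebra.Bundles using (CommutativeMonoid)
import Algebra.Properties.CommutativeMonoid.Sum as Summation
open import Data.Bool.Base using (Bool; true; false; if_then_else_; not; _∨_)
open import Data.Bool.Properties using (∨-comm; ∨-zeroʳ)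
open import Data.Fin.Base as Fin using (Fin; zero; suc; toℕ)
open import Data.Fin.Permutation as Perm using (Permutation; permutation; _⟨$⟩ʳ_; _⟨$⟩ˡ_)
import Data.Fin.Properties as Fin
open import Data.List.Base as List using (List; []; _∷_; _++_; [_]; length; filter; allFin; lookup; map; upTo; tabulate; concatMap)
import Data.List.Properties as List
open import Data.List.Relation.Binary.Permutation.Homogeneous using (onIndices)
open import Data.List.Relation.Binary.Permutation.Propositional using (_↭_; ↭-refl; ↭-trans; ↭-reflexive; ↭⇒↭ₛ; module PermutationReasoning)
import Data.List.Relation.Binary.Permutation.Propositional.Properties as ↭
open import Data.List.Relation.Binary.Permutation.Setoid.Properties using (onIndices-lookup)
import Data.List.Relation.Unary.All.Properties as All
open import Data.Maybe.Base using (just; nothing)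
open import Data.Maybe.Properties using (just-injective)
open import Data.Nat.Base as ℕ using (ℕ; zero; suc; _+_; _*_; _^_; _∸_; _≤_; _<_; z≤n; s≤s)
open import Data.Nat.ListAction using (sum)
open import Data.Nat.ListAction.Properties using (sum-++; sum-↭)
import Data.Nat.Properties as ℕ
open import Data.Nat.Solver using (module +-*-Solver)
open import Data.Product.Base using (∃-syntax; _×_; _,_; proj₁; proj₂)
open import Data.Sum.Base as Sum using (_⊎_; inj₁; inj₂)
import Data.Vec.Base as Vec
import Data.Vec.Functional as VF
import Data.Vec.Properties as Vec
open import Function.Base using (_∘_; id)
open import Function.Bundles using (_⇔_; mk⇔; _↔_; Inverse; Equivalence)
open import Function.Properties.Inverse using (↔-refl)
open import Relation.Binary.Definitions using (tri<; tri≈; tri>)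
open import Relation.Binary.PropositionalEquality using (_≡_; _≢_; _≗_; refl; sym; trans; cong; cong₂; subst; setoid; module ≡-Reasoning)
open import Relation.Binary.PropositionalEquality.WithK using (≡-irrelevant)
open import Relation.Nullary using (yes; no; does; contradiction)
open import Relation.Nullary.Decidable using (dec-true; dec-false; does-⇔)
open import Relation.Unary using (Decidable)

private
  variable
    X Y : Set
    h m m′ n n′ : ℕ

-- Indicator sums and equality tests on finite sets

module _ {c ℓ} (M : CommutativeMonoid c ℓ) where
  open CommutativeMonoid M
  open Summation M using (sum-replicate-zero) renaming (sum to ∑)

  -- Stated for any commutative monoid because it serves both the counting in `ℕ` and the sums of
  -- field elements.
  ∑-indicator : (f : Fin n → Carrier) (i : Fin n) →
    ∑ (λ k → if does (k Fin.≟ i) then f k else ε) ≈ f i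
  ∑-indicator {suc n} f zero    =
    CommutativeMonoid.trans M (∙-congˡ (sum-replicate-zero n)) (identityʳ (f zero))
  ∑-indicator {suc n} f (suc i) =
    CommutativeMonoid.trans M (identityˡ _) (∑-indicator (f ∘ suc) i)

does-≟-comm : (i j : Fin n) → does (i Fin.≟ j) ≡ does (j Fin.≟ i)
does-≟-comm i j = does-⇔ (mk⇔ sym sym) (i Fin.≟ j) (j Fin.≟ i)

does-≟-true : {i j : Fin n} → does (i Fin.≟ j) ≡ true → i ≡ j
does-≟-true {i = i} {j} p with yes i≡j ← i Fin.≟ j = i≡j

-- Permutations of lists and of index sets

⟨$⟩ʳ-injective : (π : Permutation m n) → ∀ {i j} → π ⟨$⟩ʳ i ≡ π ⟨$⟩ʳ j → i ≡ j
⟨$⟩ʳ-injective π p = trans (sym (Perm.inverseˡ π)) (trans (cong (π ⟨$⟩ˡ_) p) (Perm.inverseˡ π))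

does-≟-⟨$⟩ʳ : (π : Permutation m n) → ∀ i j → does ((π ⟨$⟩ʳ i) Fin.≟ (π ⟨$⟩ʳ j)) ≡ does (i Fin.≟ j)
does-≟-⟨$⟩ʳ π i j = does-⇔ (mk⇔ (⟨$⟩ʳ-injective π) (cong (π ⟨$⟩ʳ_))) (_ Fin.≟ _) (i Fin.≟ j)

-- Lists up to `↭` form a commutative monoid under `++`, and `tabulate f` is the sum of its
-- singletons there, so this is the invariance of a finite sum under reindexing.
tabulate-permute : (f : Fin n → X) (π : Permutation m n) →
  tabulate f ↭ tabulate (f ∘ (π ⟨$⟩ʳ_))
tabulate-permute {X = X} f π = begin
  tabulate f                        ≡⟨ singletons f ⟨
  ∑ (λ i → [ f i ])                 ↭⟨ sum-permute (λ i → [ f i ]) π ⟩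
  ∑ (λ i → [ f (π ⟨$⟩ʳ i) ])        ≡⟨ singletons (f ∘ (π ⟨$⟩ʳ_)) ⟩
  tabulate (f ∘ (π ⟨$⟩ʳ_))          ∎
  where
  open PermutationReasoning
  open Summation (↭.++-commutativeMonoid {A = X}) using (sum-permute) renaming (sum to ∑)

  singletons : ∀ {k} (g : Fin k → X) → ∑ (λ i → [ g i ]) ≡ tabulate g
  singletons {zero}  g = refl
  singletons {suc k} g = cong (g zero ∷_) (singletons (g ∘ suc))

allFin-permute : (π : Permutation m n) → allFin n ↭ map (π ⟨$⟩ʳ_) (allFin m)
allFin-permute π = ↭-trans (tabulate-permute id π)
  (↭-reflexive (sym (List.map-tabulate id (π ⟨$⟩ʳ_))))

-- Turns an equality of multisets of values into a bijection of indices. The values may repeat; the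
-- bijection is the one that the derivation of `↭` induces on positions.
↭⇒permutation : (f : Fin m → X) (g : Fin n → X) → tabulate f ↭ tabulate g →
  ∃[ π ] (∀ i → f i ≡ g (π ⟨$⟩ʳ i))
↭⇒permutation f g p = castᶠ Perm.∘ₚ ρ Perm.∘ₚ castᵍ , λ i → begin
  f i                                                    ≡⟨ List.lookup-tabulate f i ⟨
  lookup (tabulate f) (castᶠ ⟨$⟩ʳ i)                     ≡⟨ onIndices-lookup (setoid _) (↭⇒↭ₛ p) _ ⟩
  lookup (tabulate g) (ρ ⟨$⟩ʳ (castᶠ ⟨$⟩ʳ i))            ≡⟨ cong (lookup (tabulate g)) (Perm.inverseˡ castᵍ) ⟨
  lookup (tabulate g) (castᵍ ⟨$⟩ˡ (castᵍ ⟨$⟩ʳ (ρ ⟨$⟩ʳ (castᶠ ⟨$⟩ʳ i))))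
                                                         ≡⟨ List.lookup-tabulate g _ ⟩
  g (castᵍ ⟨$⟩ʳ (ρ ⟨$⟩ʳ (castᶠ ⟨$⟩ʳ i)))                 ∎
  where
  open ≡-Reasoning
  castᶠ = Perm.cast-id (sym (List.length-tabulate f))
  castᵍ = Perm.cast-id (List.length-tabulate g)
  ρ = onIndices (↭⇒↭ₛ p)

++-cancelˡ-↭ : (xs : List X) {ys zs : List X} → xs ++ ys ↭ xs ++ zs → ys ↭ zs
++-cancelˡ-↭ []       p = p
++-cancelˡ-↭ (x ∷ xs) p = ++-cancelˡ-↭ xs (↭.drop-∷ p)

concatMap-↭ : {f g : X → List Y} → (∀ x → f x ↭ g x) → ∀ xs → concatMap f xs ↭ concatMap g xs
concatMap-↭ p []       = ↭-refl
concatMap-↭ p (x ∷ xs) = ↭.++⁺ (p x) (concatMap-↭ p xs)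

filter-map : {P : Y → Set} (P? : Decidable P) (f : X → Y) (xs : List X) →
  filter P? (map f xs) ≡ map f (filter (P? ∘ f) xs)
filter-map P? f []       = refl
filter-map P? f (x ∷ xs) with does (P? (f x))
... | true  = cong (f x ∷_) (filter-map P? f xs)
... | false = filter-map P? f xs

tabulate-++ : (f : Fin m → X) (g : Fin n → X) → tabulate (f VF.++ g) ≡ tabulate f ++ tabulate g
tabulate-++ {zero}  f g = refl
tabulate-++ {suc m} f g = cong (f zero ∷_) (trans
  (List.tabulate-cong (λ i → tail-++ (Fin.splitAt m i)))
  (tabulate-++ (f ∘ suc) g))
  where
  tail-++ : ∀ x → Sum.[ f , g ] (Sum.map suc id x) ≡ Sum.[ f ∘ suc , g ] x
  tail-++ (inj₁ _) = refl
  tail-++ (inj₂ _) = refl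

tabulate-concat-replicate : ∀ k (f : Fin n → X) →
  tabulate (VF.concat (VF.replicate k f)) ≡ List.concat (List.replicate k (tabulate f))
tabulate-concat-replicate         zero    f = refl
tabulate-concat-replicate {n} {X} (suc k) f = begin
  tabulate (VF.concat (VF.replicate (suc k) f))               ≡⟨ List.tabulate-cong (λ i → split (Fin.splitAt n i)) ⟩
  tabulate (f VF.++ VF.concat (VF.replicate k f))             ≡⟨ tabulate-++ f _ ⟩
  tabulate f ++ tabulate (VF.concat (VF.replicate k f))       ≡⟨ cong (tabulate f ++_) (tabulate-concat-replicate k f) ⟩
  tabulate f ++ List.concat (List.replicate k (tabulate f))   ∎
  where
  open ≡-Reasoning
  -- `VF.concat` reads its index through `quotRem`, which begins with the same `splitAt` as `VF.++`;
  -- only its result has to be compared.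
  split : (x : Fin n ⊎ Fin (k * n)) →
    f (proj₁ (Sum.[ (_, zero) , (λ i → proj₁ (Fin.quotRem {k} n i) , suc (proj₂ (Fin.quotRem {k} n i))) ]′ x))
      ≡ Sum.[ f , VF.concat (VF.replicate k f) ] x
  split (inj₁ _) = refl
  split (inj₂ _) = refl

-- Sums over lists

δ : Bool → ℕ
δ b = if b then 1 else 0

total : (X → ℕ) → List X → ℕ
total f xs = sum (map f xs)

total-cong : {f g : X → ℕ} → f ≗ g → total f ≗ total g
total-cong f≗g xs = cong sum (List.map-cong f≗g xs)

total-↭ : (f : X → ℕ) {xs ys : List X} → xs ↭ ys → total f xs ≡ total f ys
total-↭ f p = sum-↭ (↭.map⁺ f p)

total-++ : (f : X → ℕ) (xs ys : List X) → total f (xs ++ ys) ≡ total f xs + total f ys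
total-++ f xs ys = trans (cong sum (List.map-++ f xs ys)) (sum-++ (map f xs) (map f ys))

total-map : (f : Y → ℕ) (g : X → Y) (xs : List X) → total f (map g xs) ≡ total (f ∘ g) xs
total-map f g xs = cong sum (sym (List.map-∘ xs))

total-concatMap : (f : Y → ℕ) (g : X → List Y) (xs : List X) →
  total f (concatMap g xs) ≡ total (total f ∘ g) xs
total-concatMap f g []       = refl
total-concatMap f g (x ∷ xs) =
  trans (total-++ f (g x) _) (cong (total f (g x) +_) (total-concatMap f g xs))

total-replicate : (f : X → ℕ) (k : ℕ) (x : X) → total f (List.replicate k x) ≡ k * f x
total-replicate f zero    x = refl
total-replicate f (suc k) x = cong (f x +_) (total-replicate f k x)

total-filter : {P : X → Set} (P? : Decidable P) (f : X → ℕ) (xs : List X) →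
  total f (filter P? xs) ≡ total (λ x → if does (P? x) then f x else 0) xs
total-filter P? f []       = refl
total-filter P? f (x ∷ xs) with does (P? x)
... | true  = cong (f x +_) (total-filter P? f xs)
... | false = total-filter P? f xs

open Summation ℕ.+-0-commutativeMonoid using () renaming (sum to ∑ℕ; ∑-distrib-+ to ∑ℕ-distrib-+)

total-tabulate : (f : X → ℕ) (g : Fin n → X) → total f (tabulate g) ≡ ∑ℕ (f ∘ g)
total-tabulate {n = zero}  f g = refl
total-tabulate {n = suc n} f g = cong (f (g zero) +_) (total-tabulate f (g ∘ suc))

total-allFin : (f : Fin n → ℕ) → total f (allFin n) ≡ ∑ℕ f
total-allFin f = total-tabulate f id

total-indicator : (f : Fin n → ℕ) (i : Fin n) →
  total (λ k → if does (k Fin.≟ i) then f k else 0) (allFin n) ≡ f i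
total-indicator f i = trans (total-allFin (λ k → if does (k Fin.≟ i) then f k else 0))
  (∑-indicator ℕ.+-0-commutativeMonoid f i)

total-allFin-+ : (f g : Fin n → ℕ) →
  total (λ i → f i + g i) (allFin n) ≡ total f (allFin n) + total g (allFin n)
total-allFin-+ f g = trans (total-allFin (λ i → f i + g i)) (trans (∑ℕ-distrib-+ f g)
  (sym (cong₂ _+_ (total-allFin f) (total-allFin g))))

total-upTo-< : ∀ {k l} → k ≤ l → total (λ i → δ (does (suc i ℕ.≤? k))) (upTo l) ≡ k
total-upTo-< {k} {l} k≤l = trans (cong sum (List.map-upTo _ l)) (below k≤l)
  where
  below : ∀ {k l} → k ≤ l → sum (List.applyUpTo (λ i → δ (does (suc i ℕ.≤? k))) l) ≡ k
  below {zero}  {zero}  _         = refl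
  below {zero}  {suc l} _         = below {zero} {l} z≤n
  below {suc k} {suc l} (s≤s k≤l) = cong suc (below k≤l)

-- Applied to coefficient vectors: a combination with at most one nonzero coefficient is the zero
-- word or a single row.
at-most-one : (a : Fin n → Bool) → ∑ℕ (δ ∘ a) ≤ 1 →
  (∀ i → a i ≡ false) ⊎ ∃[ j ] (∀ i → a i ≡ does (i Fin.≟ j))
at-most-one {zero}  a _ = inj₁ λ ()
at-most-one {suc n} a p with a zero in eq
... | true  = inj₂ (zero , λ { zero → eq ; (suc i) → none (a ∘ suc) (ℕ.n≤0⇒n≡0 (ℕ.s≤s⁻¹ p)) i })
  where
  none : ∀ {k} (b : Fin k → Bool) → ∑ℕ (δ ∘ b) ≡ 0 → ∀ i → b i ≡ false
  none b q zero    with false ← b zero = refl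
  none b q (suc i) = none (b ∘ suc) (ℕ.m+n≡0⇒n≡0 (δ (b zero)) q) i
... | false with at-most-one (a ∘ suc) p
...   | inj₁ none     = inj₁ λ { zero → eq ; (suc i) → none i }
...   | inj₂ (j , a≗) = inj₂ (suc j , λ { zero → eq ; (suc i) → a≗ i })

-- Final segments of an enumeration

lookup-tabulate-≡ : (f : Fin n → X) {xs : List X} → xs ≡ tabulate f → (l : Fin (length xs)) →
  ∃[ j ] lookup xs l ≡ f j × toℕ j ≡ n ∸ length xs + toℕ l
lookup-tabulate-≡ {n} f refl l = j ,
  trans (cong (lookup (tabulate f)) (sym (Perm.inverseˡ (Perm.cast-id len)))) (List.lookup-tabulate f j) ,
  -- Nothing has been dropped here, so the offset `n ∸ length xs` is 0.
  trans (Fin.toℕ-cast len l) (cong (_+ toℕ l) (sym (trans (cong (n ∸_) len) (ℕ.n∸n≡0 n))))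
  where
  len = List.length-tabulate f
  j = Fin.cast len l

-- Since `P` persists to later entries, the filter keeps a final segment; its `l`-th entry therefore
-- stands `l` places after all the dropped ones.
lookup-filter-upClosed : {P : X → Set} (P? : Decidable P) (f : Fin n → X) →
  (∀ i j → i Fin.≤ j → P (f i) → P (f j)) →
  (l : Fin (length (filter P? (tabulate f)))) →
  ∃[ j ] lookup (filter P? (tabulate f)) l ≡ f j × toℕ j ≡ n ∸ length (filter P? (tabulate f)) + toℕ l
lookup-filter-upClosed {n = suc n} P? f up l with P? (f zero)
-- If the first entry is kept, then so is every later one.
... | yes p = lookup-tabulate-≡ f
      (cong (f zero ∷_) (List.filter-all P? (All.tabulate⁺ (λ i → up zero (suc i) z≤n p)))) l
... | no ¬p with lookup-filter-upClosed P? (f ∘ suc) (λ i j i≤j → up (suc i) (suc j) (s≤s i≤j)) l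
...   | j , eq , pos = suc j , eq , trans (cong suc pos)
      (cong (_+ toℕ l) (sym (ℕ.+-∸-assoc 1 (ℕ.≤-trans (List.length-filter P? (tabulate (f ∘ suc)))
        (ℕ.≤-reflexive (List.length-tabulate (f ∘ suc)))))))

-- Edges and incidence

module _ {Γ : MultiGraph h n} where
  open MultiGraph Γ

  -- The endpoints fix the weight through `joined`, and the two proof fields are irrelevant.
  edge-ext : {a b : Edge Γ} → Edge.u a ≡ Edge.u b → Edge.v a ≡ Edge.v b → a ≡ b
  edge-ext {record { u<v = p ; joined = j }} {record { u<v = p′ ; joined = j′ }} refl refl
    with refl ← just-injective (trans (sym j) j′)
    with refl ← Fin.<-irrelevant p p′
    with refl ← ≡-irrelevant j j′ = refl

  u-incident : (a : Edge Γ) → Edge.incident a (Edge.u a) ≡ true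
  u-incident a = cong (_∨ does (Edge.u a Fin.≟ Edge.v a)) (dec-true (Edge.u a Fin.≟ Edge.u a) refl)

  v-incident : (a : Edge Γ) → Edge.incident a (Edge.v a) ≡ true
  v-incident a = trans (cong (does (Edge.v a Fin.≟ Edge.u a) ∨_) (dec-true (Edge.v a Fin.≟ Edge.v a) refl)) (∨-zeroʳ _)

  incident⇒endpoint : (a : Edge Γ) (w : Fin n) → Edge.incident a w ≡ true →
    w ≡ Edge.u a ⊎ w ≡ Edge.v a
  incident⇒endpoint a w p with w Fin.≟ Edge.u a
  ... | yes w≡u = inj₁ w≡u
  ... | no  _   = inj₂ (does-≟-true p)

  -- The graph is simple, so the set of endpoints determines the edge. Matching the endpoints
  -- crosswise would contradict that both edges list them in increasing order.
  incident-injective : {a b : Edge Γ} → Edge.incident a ≗ Edge.incident b → a ≡ b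
  incident-injective {a} {b} same
    with incident⇒endpoint b (Edge.u a) (trans (sym (same (Edge.u a))) (u-incident a))
       | incident⇒endpoint b (Edge.v a) (trans (sym (same (Edge.v a))) (v-incident a))
  ... | inj₁ p | inj₁ q = contradiction (trans p (sym q)) (Fin.<⇒≢ (Edge.u<v a))
  ... | inj₁ p | inj₂ q = edge-ext p q
  ... | inj₂ p | inj₂ q = contradiction (trans p (sym q)) (Fin.<⇒≢ (Edge.u<v a))
  ... | inj₂ p | inj₁ q = contradiction (Edge.u<v a)
    (Fin.<-asym (subst (λ x → x Fin.< Edge.u a) (sym q) (subst (Edge.u b Fin.<_) (sym p) (Edge.u<v b))))

  incident⇒weight : (a : Edge Γ) (x y : Fin n) → x ≢ y →
    Edge.incident a x ≡ true → Edge.incident a y ≡ true → weight x y ≡ just (Edge.k a)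
  incident⇒weight a x y x≢y p q with incident⇒endpoint a x p | incident⇒endpoint a y q
  ... | inj₁ refl | inj₁ refl = contradiction refl x≢y
  ... | inj₁ refl | inj₂ refl = Edge.joined a
  ... | inj₂ refl | inj₁ refl = trans (symmetric _ _) (Edge.joined a)
  ... | inj₂ refl | inj₂ refl = contradiction refl x≢y

  weight⇒≢ : {x y : Fin n} {k : Fin h} → weight x y ≡ just k → x ≢ y
  weight⇒≢ p refl with () ← trans (sym p) (loopless _)

  -- The endpoints of an edge are stored in increasing order; describing the edge by its incidences
  -- hides which of `x` and `y` comes first.
  edgeBetween : (x y : Fin n) {k : Fin h} → weight x y ≡ just k →
    ∃[ a ] (∀ w → Edge.incident {Γ = Γ} a w ≡ does (w Fin.≟ x) ∨ does (w Fin.≟ y)) × Edge.k a ≡ k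
  edgeBetween x y p with Fin.<-cmp x y
  ... | tri< x<y _ _ = record { u<v = x<y ; joined = p } , (λ _ → refl) , refl
  ... | tri≈ _ x≡y _ = contradiction x≡y (weight⇒≢ p)
  ... | tri> _ _ y<x = record { u<v = y<x ; joined = trans (symmetric y x) p } ,
        (λ w → ∨-comm (does (w Fin.≟ y)) _) , refl

  total-incident : (a : Edge Γ) → total (δ ∘ Edge.incident a) (allFin n) ≡ 2
  total-incident a = begin
    total (δ ∘ Edge.incident a) (allFin n)
      ≡⟨ total-cong split (allFin n) ⟩
    total (λ w → δ (does (w Fin.≟ Edge.u a)) + δ (does (w Fin.≟ Edge.v a))) (allFin n)
      ≡⟨ total-allFin-+ (λ w → δ (does (w Fin.≟ Edge.u a))) (λ w → δ (does (w Fin.≟ Edge.v a))) ⟩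
    total (λ w → δ (does (w Fin.≟ Edge.u a))) (allFin n) + total (λ w → δ (does (w Fin.≟ Edge.v a))) (allFin n)
      ≡⟨ cong₂ _+_ (total-indicator (λ _ → 1) (Edge.u a)) (total-indicator (λ _ → 1) (Edge.v a)) ⟩
    2 ∎
    where
    open ≡-Reasoning
    split : ∀ w → δ (Edge.incident a w) ≡ δ (does (w Fin.≟ Edge.u a)) + δ (does (w Fin.≟ Edge.v a))
    split w with w Fin.≟ Edge.u a | w Fin.≟ Edge.v a
    -- The two indicators never overlap, because the endpoints are distinct.
    ... | yes p | yes q = contradiction (trans (sym p) q) (Fin.<⇒≢ (Edge.u<v a))
    ... | yes _ | no  _ = refl
    ... | no  _ | yes _ = refl
    ... | no  _ | no  _ = refl

-- Edge orderings and incidence isomorphisms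

edge-injective : {Γ : MultiGraph h n} (o : EdgeOrdering Γ m) → ∀ {i j} →
  EdgeOrdering.edge o i ≡ EdgeOrdering.edge o j → i ≡ j
edge-injective o p = trans (sym (Inverse.strictlyInverseʳ bijection _))
  (trans (cong (Inverse.from bijection) p) (Inverse.strictlyInverseʳ bijection _))
  where open EdgeOrdering o

-- The middle term between isomorphism of multi-graphs and equivalence of codes: edges are named by
-- their positions, that is, by the rows of the matrix, and vertices by the columns of `A`.
record IncidenceIso {Γ : MultiGraph h n} {Γ′ : MultiGraph h n′}
                    (o : EdgeOrdering Γ m) (o′ : EdgeOrdering Γ′ m′) : Set where
  open EdgeOrdering o using (edge)
  open EdgeOrdering o′ using () renaming (edge to edge′)
  field
    edges      : Permutation m m′
    vertices   : Permutation n n′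
    incidences : ∀ j v → Edge.incident (edge′ (edges ⟨$⟩ʳ j)) (vertices ⟨$⟩ʳ v) ≡ Edge.incident (edge j) v
    weights    : ∀ j → Edge.edgeWeight (edge′ (edges ⟨$⟩ʳ j)) ≡ Edge.edgeWeight (edge j)

module _ {Γ : MultiGraph h n} {Γ′ : MultiGraph h n′} where
  private
    module Γ  = MultiGraph Γ
    module Γ′ = MultiGraph Γ′

  mapEdge : (iso : Γ ≅ Γ′) (a : Edge Γ) →
    ∃[ b ] (∀ w → Edge.incident {Γ = Γ′} b (_≅_.vertices iso ⟨$⟩ʳ w) ≡ Edge.incident a w) × Edge.k b ≡ Edge.k a
  mapEdge iso a with edgeBetween _ _ (trans (_≅_.weights iso (Edge.u a) (Edge.v a)) (Edge.joined a))
  ... | b , inc , k≡ = b ,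
    (λ w → trans (inc (ψ ⟨$⟩ʳ w)) (cong₂ _∨_ (does-≟-⟨$⟩ʳ ψ w _) (does-≟-⟨$⟩ʳ ψ w _))) , k≡
    where ψ = _≅_.vertices iso

  module _ {o : EdgeOrdering Γ m} {o′ : EdgeOrdering Γ′ m′} where
    open EdgeOrdering o using (edge; bijection)
    open EdgeOrdering o′ using () renaming (edge to edge′)

    -- The image of the edge joining `x` and `y` is incident with both image vertices. These are
    -- distinct, so it is the edge joining them, and it has the same weight.
    IncidenceIso-weight : (I : IncidenceIso o o′) → ∀ {x y k} → Γ.weight x y ≡ just k →
      Γ′.weight (IncidenceIso.vertices I ⟨$⟩ʳ x) (IncidenceIso.vertices I ⟨$⟩ʳ y) ≡ just k
    IncidenceIso-weight I {x} {y} {k} p with edgeBetween {Γ = Γ} x y p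
    ... | a , inc , refl = trans
      (incident⇒weight (edge′ (edges ⟨$⟩ʳ j)) _ _ ψx≢ψy
        (on x (trans (inc x) (cong (_∨ does (x Fin.≟ y)) (dec-true (x Fin.≟ x) refl))))
        (on y (trans (inc y) (trans (cong (does (y Fin.≟ x) ∨_) (dec-true (y Fin.≟ y) refl)) (∨-zeroʳ _)))))
      (cong just (Fin.toℕ-injective (ℕ.suc-injective (trans (weights j) (cong Edge.edgeWeight edge-j)))))
      where
      open IncidenceIso I
      j = Inverse.from bijection a
      edge-j : edge j ≡ a
      edge-j = Inverse.strictlyInverseˡ bijection a
      on : ∀ w → Edge.incident a w ≡ true → Edge.incident (edge′ (edges ⟨$⟩ʳ j)) (vertices ⟨$⟩ʳ w) ≡ true
      on w q = trans (incidences j w) (trans (cong (λ b → Edge.incident b w) edge-j) q)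
      ψx≢ψy : vertices ⟨$⟩ʳ x ≢ vertices ⟨$⟩ʳ y
      ψx≢ψy q = weight⇒≢ {Γ = Γ} p (⟨$⟩ʳ-injective vertices q)

≅-sym : {Γ : MultiGraph h n} {Γ′ : MultiGraph h n′} → Γ ≅ Γ′ → Γ′ ≅ Γ
≅-sym {Γ = Γ} {Γ′} iso = record
  { vertices = Perm.flip ψ
  ; weights  = λ u v → trans (sym (_≅_.weights iso (ψ ⟨$⟩ˡ u) (ψ ⟨$⟩ˡ v)))
      (cong₂ (MultiGraph.weight Γ′) (Perm.inverseʳ ψ) (Perm.inverseʳ ψ))
  }
  where ψ = _≅_.vertices iso

module _ {Γ : MultiGraph h n} {Γ′ : MultiGraph h n′} {o : EdgeOrdering Γ m} {o′ : EdgeOrdering Γ′ m′} where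
  open EdgeOrdering o using (edge; bijection)
  open EdgeOrdering o′ using () renaming (edge to edge′; bijection to bijection′)

  IncidenceIso-sym : IncidenceIso o o′ → IncidenceIso o′ o
  IncidenceIso-sym I = record
    { edges      = Perm.flip edges
    ; vertices   = Perm.flip vertices
    ; incidences = λ j v → trans (sym (incidences (edges ⟨$⟩ˡ j) (vertices ⟨$⟩ˡ v)))
        (cong₂ (λ i → Edge.incident (edge′ i)) (Perm.inverseʳ edges) (Perm.inverseʳ vertices))
    ; weights    = λ j → trans (sym (weights (edges ⟨$⟩ˡ j)))
        (cong (Edge.edgeWeight ∘ edge′) (Perm.inverseʳ edges))
    }
    where open IncidenceIso I

  IncidenceIso⇒≅ : IncidenceIso o o′ → Γ ≅ Γ′
  IncidenceIso⇒≅ I = record { vertices = vertices ; weights = preserved }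
    where
    open IncidenceIso I
    module Γ  = MultiGraph Γ
    module Γ′ = MultiGraph Γ′
    preserved : ∀ u v → Γ′.weight (vertices ⟨$⟩ʳ u) (vertices ⟨$⟩ʳ v) ≡ Γ.weight u v
    preserved u v with Γ.weight u v in eq
    ... | just k  = IncidenceIso-weight I eq
    ... | nothing with Γ′.weight (vertices ⟨$⟩ʳ u) (vertices ⟨$⟩ʳ v) in eq′
    ...   | nothing = refl
    -- An edge between the images would be carried back by the inverse to an edge between `u` and
    -- `v`.
    ...   | just k  with () ← trans (sym eq) (trans
              (cong₂ Γ.weight (sym (Perm.inverseˡ vertices)) (sym (Perm.inverseˡ vertices)))
              (IncidenceIso-weight (IncidenceIso-sym I) eq′))

  -- The edge maps of the isomorphism and of its inverse are mutually inverse because their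
  -- composites preserve incidence, which determines an edge.
  ≅⇒IncidenceIso : Γ ≅ Γ′ → IncidenceIso o o′
  ≅⇒IncidenceIso iso = record
    { edges      = permutation φ φ⁻¹ φφ⁻¹ φ⁻¹φ
    ; vertices   = ψ
    ; incidences = φ-incident
    ; weights    = λ j → trans (cong Edge.edgeWeight (edge′-φ j))
        (cong (suc ∘ toℕ) (proj₂ (proj₂ (mapEdge iso (edge j)))))
    }
    where
    ψ = _≅_.vertices iso
    φ : Fin m → Fin m′
    φ j = Inverse.from bijection′ (proj₁ (mapEdge iso (edge j)))
    φ⁻¹ : Fin m′ → Fin m
    φ⁻¹ j = Inverse.from bijection (proj₁ (mapEdge (≅-sym iso) (edge′ j)))
    edge′-φ : ∀ j → edge′ (φ j) ≡ proj₁ (mapEdge iso (edge j))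
    edge′-φ j = Inverse.strictlyInverseˡ bijection′ _
    edge-φ⁻¹ : ∀ j → edge (φ⁻¹ j) ≡ proj₁ (mapEdge (≅-sym iso) (edge′ j))
    edge-φ⁻¹ j = Inverse.strictlyInverseˡ bijection _
    φ-incident : ∀ j v → Edge.incident (edge′ (φ j)) (ψ ⟨$⟩ʳ v) ≡ Edge.incident (edge j) v
    φ-incident j v = trans (cong (λ a → Edge.incident a (ψ ⟨$⟩ʳ v)) (edge′-φ j))
      (proj₁ (proj₂ (mapEdge iso (edge j))) v)
    φ⁻¹-incident : ∀ j v → Edge.incident (edge (φ⁻¹ j)) (ψ ⟨$⟩ˡ v) ≡ Edge.incident (edge′ j) v
    φ⁻¹-incident j v = trans (cong (λ a → Edge.incident a (ψ ⟨$⟩ˡ v)) (edge-φ⁻¹ j))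
      (proj₁ (proj₂ (mapEdge (≅-sym iso) (edge′ j))) v)
    φ⁻¹φ : ∀ j → φ⁻¹ (φ j) ≡ j
    φ⁻¹φ j = edge-injective o (incident-injective λ v → trans
      (cong (Edge.incident (edge (φ⁻¹ (φ j)))) (sym (Perm.inverseˡ ψ)))
      (trans (φ⁻¹-incident (φ j) (ψ ⟨$⟩ʳ v)) (φ-incident j v)))
    φφ⁻¹ : ∀ j → φ (φ⁻¹ j) ≡ j
    φφ⁻¹ j = edge-injective o′ (incident-injective λ v → trans
      (cong (Edge.incident (edge′ (φ (φ⁻¹ j)))) (sym (Perm.inverseʳ ψ)))
      (trans (φ-incident (φ⁻¹ j) (ψ ⟨$⟩ˡ v)) (φ⁻¹-incident j v)))

-- Columns of G(Γ)

-- The indices of the blocks D of the matrix, from left to right.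
levels : ℕ → List ℕ
levels h = List.replicate (h + 2) 1 ++ 2⋯ h

module _ {Γ : MultiGraph h n} (o : EdgeOrdering Γ m) where
  open EdgeOrdering o

  -- Up to the value of its nonzero entries, a column of G(Γ) is determined by a
  -- single edge (columns of the blocks D) or by a vertex (columns of A).
  Label : Set
  Label = Fin m ⊎ Fin n

  labels : List Label
  labels = map inj₁ (concatMap (E o) (levels h)) ++ map inj₂ (allFin n)

  -- The support of row `j`, once `e` is nonzero.
  meets : Fin m → Label → Bool
  meets j (inj₁ l) = does (j Fin.≟ l)
  meets j (inj₂ v) = Edge.incident (edge j) v

  blockLabels : (is : List ℕ) → Fin (sum (map ∣E o ∣ is)) → Label
  blockLabels []       ()
  blockLabels (i ∷ is) = (inj₁ ∘ lookup (E o i)) VF.++ blockLabels is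

  -- Built in the same shape as `G`, so that entries can be compared case by case; `labels` is the
  -- flat list used for counting.
  label : Fin (codeLength o) → Label
  label = VF.concat (VF.replicate (h + 2) (inj₁ ∘ lookup (E o 1))) VF.++ (blockLabels (2⋯ h) VF.++ inj₂)

  private
    tabulate-block : ∀ i → tabulate {A = Label} (inj₁ ∘ lookup (E o i)) ≡ map inj₁ (E o i)
    tabulate-block i = trans (sym (List.map-tabulate (lookup (E o i)) inj₁))
      (cong (map inj₁) (List.tabulate-lookup (E o i)))

    tabulate-blockLabels : ∀ is → tabulate (blockLabels is) ≡ map inj₁ (concatMap (E o) is)
    tabulate-blockLabels []       = refl
    tabulate-blockLabels (i ∷ is) = begin
      tabulate (blockLabels (i ∷ is))                               ≡⟨ tabulate-++ (inj₁ ∘ lookup (E o i)) _ ⟩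
      tabulate (inj₁ ∘ lookup (E o i)) ++ tabulate (blockLabels is) ≡⟨ cong₂ _++_ (tabulate-block i) (tabulate-blockLabels is) ⟩
      map inj₁ (E o i) ++ map inj₁ (concatMap (E o) is)             ≡⟨ List.map-++ inj₁ (E o i) _ ⟨
      map inj₁ (concatMap (E o) (i ∷ is))                           ∎
      where open ≡-Reasoning

    tabulate-repeated : ∀ k → tabulate {A = Label} (VF.concat (VF.replicate k (inj₁ ∘ lookup (E o 1)))) ≡
      map inj₁ (concatMap (E o) (List.replicate k 1))
    tabulate-repeated k = trans (tabulate-concat-replicate k _) (repeated k)
      where
      repeated : ∀ k → List.concat (List.replicate k (tabulate {A = Label} (inj₁ ∘ lookup (E o 1)))) ≡
        map inj₁ (concatMap (E o) (List.replicate k 1))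
      repeated zero    = refl
      repeated (suc k) = trans (cong₂ _++_ (tabulate-block 1) (repeated k)) (sym (List.map-++ inj₁ (E o 1) _))

  tabulate-label : tabulate label ≡ labels
  tabulate-label = begin
    tabulate label
      ≡⟨ tabulate-++ repeated _ ⟩
    tabulate repeated ++ tabulate (blockLabels (2⋯ h) VF.++ inj₂)
      ≡⟨ cong (tabulate repeated ++_) (tabulate-++ (blockLabels (2⋯ h)) inj₂) ⟩
    tabulate repeated ++ tabulate (blockLabels (2⋯ h)) ++ tabulate inj₂
      ≡⟨ cong₂ _++_ (tabulate-repeated (h + 2)) (cong₂ _++_ (tabulate-blockLabels (2⋯ h)) (sym (List.map-tabulate id inj₂))) ⟩
    map inj₁ (concatMap (E o) ones) ++ map inj₁ (concatMap (E o) (2⋯ h)) ++ map inj₂ (allFin n)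
      ≡⟨ List.++-assoc (map inj₁ (concatMap (E o) ones)) _ _ ⟨
    (map inj₁ (concatMap (E o) ones) ++ map inj₁ (concatMap (E o) (2⋯ h))) ++ map inj₂ (allFin n)
      ≡⟨ cong (_++ map inj₂ (allFin n)) (List.map-++ inj₁ (concatMap (E o) ones) _) ⟨
    map inj₁ (concatMap (E o) ones ++ concatMap (E o) (2⋯ h)) ++ map inj₂ (allFin n)
      ≡⟨ cong (λ xs → map inj₁ xs ++ map inj₂ (allFin n)) (List.concatMap-++ (E o) ones (2⋯ h)) ⟨
    labels ∎
    where
    open ≡-Reasoning
    repeated = VF.concat (VF.replicate (h + 2) (inj₁ ∘ lookup (E o 1)))
    ones = List.replicate (h + 2) 1

  -- The edges are ordered by weight, so `E i` is a final segment of the rows. This is why `D i`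
  -- sits correctly below the zero block.
  toℕ-lookup-E : ∀ i l → toℕ (lookup (E o i) l) ≡ m ∸ ∣E o ∣ i + toℕ l
  toℕ-lookup-E i l with lookup-filter-upClosed (λ j → i ℕ.≤? Edge.edgeWeight (edge j)) id
    (λ j j′ j≤j′ i≤ → ℕ.≤-trans i≤ (monotone j j′ j≤j′)) l
  ... | j , eq , pos = trans (cong toℕ eq) pos

  E₁≡allFin : E o 1 ≡ allFin m
  E₁≡allFin = List.filter-all _ (All.tabulate⁺ (λ _ → s≤s z≤n))

  total-blocks : (f : Fin m → ℕ) → total f (concatMap (E o) (levels h)) ≡
    (h + 2) * total f (allFin m) + total (total f ∘ E o) (2⋯ h)
  total-blocks f = begin
    total f (concatMap (E o) (levels h))
      ≡⟨ total-concatMap f (E o) (levels h) ⟩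
    total (total f ∘ E o) (levels h)
      ≡⟨ total-++ (total f ∘ E o) (List.replicate (h + 2) 1) (2⋯ h) ⟩
    total (total f ∘ E o) (List.replicate (h + 2) 1) + total (total f ∘ E o) (2⋯ h)
      ≡⟨ cong (_+ total (total f ∘ E o) (2⋯ h)) (trans (total-replicate (total f ∘ E o) (h + 2) 1)
           (cong (λ xs → (h + 2) * total f xs) E₁≡allFin)) ⟩
    (h + 2) * total f (allFin m) + total (total f ∘ E o) (2⋯ h) ∎
    where open ≡-Reasoning

  total-labels : (f : Label → ℕ) → total f labels ≡
    (h + 2) * total (f ∘ inj₁) (allFin m) + total (total (f ∘ inj₁) ∘ E o) (2⋯ h) + total (f ∘ inj₂) (allFin n)
  total-labels f = begin
    total f labels
      ≡⟨ total-++ f (map inj₁ (concatMap (E o) (levels h))) _ ⟩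
    total f (map inj₁ (concatMap (E o) (levels h))) + total f (map inj₂ (allFin n))
      ≡⟨ cong₂ _+_ (trans (total-map f inj₁ (concatMap (E o) (levels h))) (total-blocks (f ∘ inj₁))) (total-map f inj₂ (allFin n)) ⟩
    _ ∎
    where open ≡-Reasoning

  -- For an edge of weight `w`, the copies of D₁ contribute `h + 2`, the blocks of levels 2 to `w`
  -- contribute one each, and the two endpoints contribute 2 in `A`.
  total-meets : ∀ j → total (δ ∘ meets j) labels ≡ h + 3 + Edge.edgeWeight (edge j)
  total-meets j = begin
    total (δ ∘ meets j) labels
      ≡⟨ total-labels (δ ∘ meets j) ⟩
    (h + 2) * total (δ ∘ does ∘ (j Fin.≟_)) (allFin m) + total (total (δ ∘ does ∘ (j Fin.≟_)) ∘ E o) (2⋯ h)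
      + total (δ ∘ Edge.incident (edge j)) (allFin n)
      ≡⟨ cong₂ _+_ (cong₂ _+_ (cong ((h + 2) *_) once) higher) (total-incident (edge j)) ⟩
    (h + 2) * 1 + k + 2
      ≡⟨ solve 2 (λ h k → (h :+ con 2) :* con 1 :+ k :+ con 2 := h :+ con 3 :+ (con 1 :+ k)) refl h k ⟩
    h + 3 + suc k ∎
    where
    open ≡-Reasoning
    open +-*-Solver
    k = toℕ (Edge.k (edge j))
    once : total (δ ∘ does ∘ (j Fin.≟_)) (allFin m) ≡ 1
    once = trans (total-cong (λ l → cong δ (does-≟-comm j l)) (allFin m)) (total-indicator (λ _ → 1) j)
    swap-ifs : ∀ a b → (if a then δ b else 0) ≡ (if b then δ a else 0)
    swap-ifs false false = refl
    swap-ifs false true  = refl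
    swap-ifs true  false = refl
    swap-ifs true  true  = refl
    inE : ∀ i → total (δ ∘ does ∘ (j Fin.≟_)) (E o i) ≡ δ (does (i ℕ.≤? suc k))
    inE i = begin
      total (δ ∘ does ∘ (j Fin.≟_)) (E o i)
        ≡⟨ total-filter (λ l → i ℕ.≤? Edge.edgeWeight (edge l)) (δ ∘ does ∘ (j Fin.≟_)) (allFin m) ⟩
      total (λ l → if does (i ℕ.≤? Edge.edgeWeight (edge l)) then δ (does (j Fin.≟ l)) else 0) (allFin m)
        ≡⟨ total-cong (λ l → trans (cong (λ b → if does (i ℕ.≤? Edge.edgeWeight (edge l)) then δ b else 0) (does-≟-comm j l))
             (swap-ifs (does (i ℕ.≤? Edge.edgeWeight (edge l))) (does (l Fin.≟ j)))) (allFin m) ⟩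
      total (λ l → if does (l Fin.≟ j) then δ (does (i ℕ.≤? Edge.edgeWeight (edge l))) else 0) (allFin m)
        ≡⟨ total-indicator (λ l → δ (does (i ℕ.≤? Edge.edgeWeight (edge l)))) j ⟩
      δ (does (i ℕ.≤? suc k)) ∎
    higher : total (total (δ ∘ does ∘ (j Fin.≟_)) ∘ E o) (2⋯ h) ≡ k
    higher = begin
      total (total (δ ∘ does ∘ (j Fin.≟_)) ∘ E o) (2⋯ h)
        ≡⟨ total-cong inE (2⋯ h) ⟩
      total (λ i → δ (does (i ℕ.≤? suc k))) (2⋯ h)
        ≡⟨ total-map (λ i → δ (does (i ℕ.≤? suc k))) (2 +_) (upTo (h ∸ 1)) ⟩
      -- The entry `i` of `upTo` stands for level `2 + i`, and the test `2 + i ≤ suc k` reduces to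
      -- `suc i ≤ k`.
      total (λ i → δ (does (suc i ℕ.≤? k))) (upTo (h ∸ 1))
        ≡⟨ total-upTo-< (ℕ.∸-monoˡ-≤ 1 (Fin.toℕ<n (Edge.k (edge j)))) ⟩
      k ∎

  total-label : (f : Label → ℕ) → total (f ∘ label) (allFin (codeLength o)) ≡ total f labels
  total-label f = begin
    total (f ∘ label) (allFin (codeLength o))      ≡⟨ total-map f label (allFin (codeLength o)) ⟨
    total f (map label (allFin (codeLength o)))    ≡⟨ cong (total f) (List.map-tabulate id label) ⟩
    total f (tabulate label)                       ≡⟨ cong (total f) tabulate-label ⟩
    total f labels                                 ∎
    where open ≡-Reasoning

  support-weight : ∀ j → total (δ ∘ meets j ∘ label) (allFin (codeLength o)) ≡ h + 3 + Edge.edgeWeight (edge j)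
  support-weight j = trans (total-label (δ ∘ meets j)) (total-meets j)

  vertexColumn : ∀ v → ∃[ c ] label c ≡ inj₂ v
  -- `a` counts the columns of the copies of D₁ and `b` those of the higher blocks; the columns of
  -- `A` follow.
  vertexColumn v = a Fin.↑ʳ (b Fin.↑ʳ v) , eq
    where
    a = (h + 2) * ∣E o ∣ 1
    b = sum (map ∣E o ∣ (2⋯ h))
    eq : label (a Fin.↑ʳ (b Fin.↑ʳ v)) ≡ inj₂ v
    eq rewrite Fin.splitAt-↑ʳ a (b + n) (b Fin.↑ʳ v) | Fin.splitAt-↑ʳ b n v = refl

  -- Equal supports agree in particular on the columns of `A`, where they are the endpoint sets of
  -- the edges.
  support-injective : ∀ {i j} → (∀ c → meets i (label c) ≡ meets j (label c)) → i ≡ j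
  support-injective {i} {j} same = edge-injective o (incident-injective at)
    where
    at : ∀ v → Edge.incident (edge i) v ≡ Edge.incident (edge j) v
    at v with c , eq ← vertexColumn v = subst (λ x → meets i x ≡ meets j x) eq (same c)

  module _ {q : ℕ} (F : FiniteField q) (e : FiniteField.Carrier F) where
    open FiniteField F using (Carrier; 0#)

    incidenceEntry : Fin m → Label → Carrier
    incidenceEntry j x = if meets j x then entry o F e j else 0#

    block-entry : ∀ i j l → block o F e i j l ≡ incidenceEntry j (inj₁ (lookup (E o i) l))
    block-entry i j l = split (Fin.splitAt (m ∸ ∣E o ∣ i) j′) refl
      where
      cast-eq = sym (ℕ.m∸n+n≡m (∣E∣≤m o i))
      j′ = Fin.cast cast-eq j
      toℕ-j′ : toℕ j′ ≡ toℕ j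
      toℕ-j′ = Fin.toℕ-cast cast-eq j
      split : ∀ x → Fin.splitAt (m ∸ ∣E o ∣ i) j′ ≡ x →
        Sum.[ O o F e i , D o F e i ]′ x l ≡ incidenceEntry j (inj₁ (lookup (E o i) l))
      -- A row of the zero block precedes the final segment `E i`, so its edge cannot be the one of
      -- column `l`.
      split (inj₁ x) eq with j Fin.≟ lookup (E o i) l
      ... | no  _    = refl
      ... | yes refl = contradiction
        (ℕ.≤-trans (ℕ.m≤m+n (m ∸ ∣E o ∣ i) (toℕ l)) (ℕ.≤-reflexive (trans (sym (toℕ-lookup-E i l)) (trans (sym toℕ-j′)
          (trans (cong toℕ (sym (Fin.splitAt⁻¹-↑ˡ eq))) (Fin.toℕ-↑ˡ x (∣E o ∣ i)))))))
        (ℕ.<⇒≱ (Fin.toℕ<n x))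
      -- Row `k` of `D i` belongs to the edge `lookup (E o i) k`, which is `j`. As `E o i` has no
      -- repetitions, comparing places in it is comparing edges.
      split (inj₂ k) eq = trans (cong (λ b → if b then entry o F e (lookup (E o i) k) else 0#) same)
        (cong (λ z → incidenceEntry z (inj₁ (lookup (E o i) l))) (sym j≡))
        where
        toℕ-j : toℕ j ≡ m ∸ ∣E o ∣ i + toℕ k
        toℕ-j = trans (sym toℕ-j′) (trans (cong toℕ (sym (Fin.splitAt⁻¹-↑ʳ eq))) (Fin.toℕ-↑ʳ (m ∸ ∣E o ∣ i) k))
        j≡ : j ≡ lookup (E o i) k
        j≡ = Fin.toℕ-injective (trans toℕ-j (sym (toℕ-lookup-E i k)))
        same : does (k Fin.≟ l) ≡ does (lookup (E o i) k Fin.≟ lookup (E o i) l)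
        same = does-⇔ (mk⇔ (cong (lookup (E o i))) injective) (k Fin.≟ l) (_ Fin.≟ _)
          where
          injective : lookup (E o i) k ≡ lookup (E o i) l → k ≡ l
          injective p = Fin.toℕ-injective (ℕ.+-cancelˡ-≡ (m ∸ ∣E o ∣ i) _ _
            (trans (sym (toℕ-lookup-E i k)) (trans (cong toℕ p) (toℕ-lookup-E i l))))

    blocks-entry : ∀ is j l → blocks o F e is j l ≡ incidenceEntry j (blockLabels is l)
    blocks-entry (i ∷ is) j l with Fin.splitAt (∣E o ∣ i) l
    ... | inj₁ x = block-entry i j x
    ... | inj₂ y = blocks-entry is j y

    G-entry : ∀ j c → G o F e j c ≡ incidenceEntry j (label c)
    G-entry j c with Fin.splitAt ((h + 2) * ∣E o ∣ 1) c
    ... | inj₁ x = block-entry 1 j _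
    ... | inj₂ y with Fin.splitAt (sum (map ∣E o ∣ (2⋯ h))) y
    ...   | inj₁ z = blocks-entry (2⋯ h) j z
    ...   | inj₂ v = refl

-- Blocks under a weight-preserving bijection of edges

module _ {Γ : MultiGraph h n} {Γ′ : MultiGraph h n′} (o : EdgeOrdering Γ m) (o′ : EdgeOrdering Γ′ m′)
         (φ : Permutation m m′)
         (weights : ∀ j → Edge.edgeWeight (EdgeOrdering.edge o′ (φ ⟨$⟩ʳ j)) ≡ Edge.edgeWeight (EdgeOrdering.edge o j)) where

  -- The condition `i ≤ edgeWeight` is carried to itself. Edges of equal weight may be listed in
  -- another order, hence `↭`.
  E-permute : ∀ i → E o′ i ↭ map (φ ⟨$⟩ʳ_) (E o i)
  E-permute i = begin
    filter P′ (allFin m′)                               ↭⟨ ↭.filter-↭ P′ (allFin-permute φ) ⟩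
    filter P′ (map (φ ⟨$⟩ʳ_) (allFin m))                ≡⟨ filter-map P′ (φ ⟨$⟩ʳ_) (allFin m) ⟩
    map (φ ⟨$⟩ʳ_) (filter (P′ ∘ (φ ⟨$⟩ʳ_)) (allFin m))  ≡⟨ cong (map (φ ⟨$⟩ʳ_)) (List.filter-≐ _ _
        ((λ {j} → subst (i ≤_) (weights j)) , (λ {j} → subst (i ≤_) (sym (weights j)))) (allFin m)) ⟩
    map (φ ⟨$⟩ʳ_) (E o i)                               ∎
    where
    open PermutationReasoning
    P′ = λ j → i ℕ.≤? Edge.edgeWeight (EdgeOrdering.edge o′ j)

  blocks-permute : ∀ is → concatMap (E o′) is ↭ map (φ ⟨$⟩ʳ_) (concatMap (E o) is)
  blocks-permute is = ↭-trans (concatMap-↭ E-permute is)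
    (↭-reflexive (sym (List.map-concatMap (φ ⟨$⟩ʳ_) (E o) is)))

-- Codewords of small weight

module _ (r : ℕ) (F : FiniteField (2 ^ r)) where
  open FiniteField F renaming (_+_ to _⊕_; _*_ to _⊛_; _^_ to _↑_; +-assoc to ⊕-assoc)
  open Summation +-commutativeMonoid using (sum-cong-≗; sum-replicate-zero) renaming (sum to ∑)

  ^-nonzero : ∀ {x} → x ≢ 0# → ∀ k → x ↑ k ≢ 0#
  ^-nonzero     x≢0 zero    p = 0≢1 (sym p)
  ^-nonzero {x} x≢0 (suc k) p with inverse x x≢0
  ... | y , xy≡1 = ^-nonzero x≢0 k (begin
    x ↑ k              ≡⟨ *-identityˡ (x ↑ k) ⟨
    1# ⊛ x ↑ k         ≡⟨ cong (_⊛ x ↑ k) (trans (*-comm y x) xy≡1) ⟨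
    (y ⊛ x) ⊛ x ↑ k    ≡⟨ *-assoc y x (x ↑ k) ⟩
    y ⊛ (x ⊛ x ↑ k)    ≡⟨ cong (y ⊛_) p ⟩
    y ⊛ 0#             ≡⟨ zeroʳ y ⟩
    0#                 ∎)
    where open ≡-Reasoning

  nonzero : Carrier → Bool
  nonzero x = not (does (x ≟ 0#))

  nonzero-0# : nonzero 0# ≡ false
  nonzero-0# = cong not (dec-true (0# ≟ 0#) refl)

  nonzero-if : ∀ b {x} → x ≢ 0# → nonzero (if b then x else 0#) ≡ b
  nonzero-if false     x≢0 = nonzero-0#
  nonzero-if true  {x} x≢0 = cong not (dec-false (x ≟ 0#) x≢0)

  x+y+y≡x : ∀ x y → (x ⊕ y) ⊕ y ≡ x
  x+y+y≡x x y = trans (⊕-assoc x y y) (trans (cong (x ⊕_) (characteristic-2 r F y)) (+-identityʳ x))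

  x+y≡0⇒x≡y : ∀ {x y} → x ⊕ y ≡ 0# → x ≡ y
  x+y≡0⇒x≡y {x} {y} p = trans (sym (x+y+y≡x x y)) (trans (cong (_⊕ y) p) (+-identityˡ y))

  -- In characteristic 2 the sum vanishes exactly when `σ` takes the same value at `x` and at `0#`,
  -- which by injectivity means that `x` is zero.
  nonzero-translate : (σ : Carrier ↔ Carrier) (x : Carrier) →
    nonzero (Inverse.to σ x ⊕ Inverse.to σ 0#) ≡ nonzero x
  nonzero-translate σ x = cong not (does-⇔ (mk⇔ ⇒ ⇐) (_ ≟ 0#) (x ≟ 0#))
    where
    ⇒ : Inverse.to σ x ⊕ Inverse.to σ 0# ≡ 0# → x ≡ 0#
    ⇒ p = trans (sym (Inverse.strictlyInverseʳ σ x))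
      (trans (cong (Inverse.from σ) (x+y≡0⇒x≡y p)) (Inverse.strictlyInverseʳ σ 0#))
    ⇐ : x ≡ 0# → Inverse.to σ x ⊕ Inverse.to σ 0# ≡ 0#
    ⇐ refl = characteristic-2 r F _

  hammingWeight : ∀ {N} → (Fin N → Carrier) → ℕ
  hammingWeight {N} c = total (δ ∘ nonzero ∘ c) (allFin N)

  combination-unit : ∀ {N} (M : Matrix Carrier m N) j c →
    combination r F (λ i → does (i Fin.≟ j)) M c ≡ M j c
  combination-unit M j c = ∑-indicator +-commutativeMonoid (λ i → M i c) j

  row∈rowSpan : ∀ {N} (M : Matrix Carrier m N) j → AdditiveCode.Member (rowSpan r F M) (M j)
  row∈rowSpan M j = _ , λ c → sym (combination-unit M j c)

  combination-cong : ∀ {N} {a b : Fin m → Bool} (M : Matrix Carrier m N) → a ≗ b →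
    combination r F a M ≗ combination r F b M
  combination-cong M a≗b c = sum-cong-≗ (λ j → cong (λ b → if b then M j c else 0#) (a≗b j))

  module _ {e : Carrier} (e≢0 : e ≢ 0#) {Γ : MultiGraph h n} (o : EdgeOrdering Γ m) where
    open AdditiveCode (rowSpan r F (G o F e)) using (Member)

    private
      N : ℕ
      N = codeLength o

    entry-nonzero : ∀ j → entry o F e j ≢ 0#
    entry-nonzero j = ^-nonzero e≢0 (toℕ (Edge.k (EdgeOrdering.edge o j)))

    nonzero-G : ∀ j c → nonzero (G o F e j c) ≡ meets o j (label o c)
    nonzero-G j c = trans (cong nonzero (G-entry o F e j c)) (nonzero-if (meets o j (label o c)) (entry-nonzero j))

    -- The codeword with coefficients `a`, as a function of the label of a column, so that its
    -- weight can be computed by `total-labels`.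
    labelWord : (Fin m → Bool) → Label o → Carrier
    labelWord a x = ∑ (λ j → if a j then incidenceEntry o F e j x else 0#)

    combination-G : ∀ a c → combination r F a (G o F e) c ≡ labelWord a (label o c)
    combination-G a c = sum-cong-≗ (λ j → cong (λ x → if a j then x else 0#) (G-entry o F e j c))

    -- A column of a block D meets a single row, so no cancellation can occur in it.
    labelWord-edge : ∀ a l → labelWord a (inj₁ l) ≡ (if a l then entry o F e l else 0#)
    labelWord-edge a l = trans
      (sum-cong-≗ (λ j → if-comm (a j) (does (j Fin.≟ l))))
      (∑-indicator +-commutativeMonoid (λ j → if a j then entry o F e j else 0#) l)
      where
      if-comm : ∀ a b {x : Carrier} →
        (if a then (if b then x else 0#) else 0#) ≡ (if b then (if a then x else 0#) else 0#)
      if-comm false false = refl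
      if-comm false true  = refl
      if-comm true  false = refl
      if-comm true  true  = refl

    hammingWeight-combination : ∀ a →
      (h + 2) * total (δ ∘ a) (allFin m) ≤ hammingWeight (combination r F a (G o F e))
    hammingWeight-combination a = begin
      (h + 2) * total (δ ∘ a) (allFin m)
        ≡⟨ cong ((h + 2) *_) (total-cong (λ l → cong δ (sym (trans (cong nonzero (labelWord-edge a l))
             (nonzero-if (a l) (entry-nonzero l))))) (allFin m)) ⟩
      (h + 2) * total (w ∘ inj₁) (allFin m)
        -- The higher blocks and `A`, where rows may cancel, are discarded.
        ≤⟨ ℕ.≤-trans (ℕ.m≤m+n _ _) (ℕ.m≤m+n _ _) ⟩
      (h + 2) * total (w ∘ inj₁) (allFin m) + total (total (w ∘ inj₁) ∘ E o) (2⋯ h) + total (w ∘ inj₂) (allFin n)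
        ≡⟨ total-labels o w ⟨
      total w (labels o)
        ≡⟨ total-label o w ⟨
      total (w ∘ label o) (allFin N)
        ≡⟨ total-cong (λ c → cong (δ ∘ nonzero) (combination-G a c)) (allFin N) ⟨
      hammingWeight (combination r F a (G o F e)) ∎
      where
      open ℕ.≤-Reasoning
      w : Label o → ℕ
      w = δ ∘ nonzero ∘ labelWord a

    -- The bound equals `2 * (h + 2) ∸ 1`, one less than what two rows already contribute on the
    -- copies of D₁.
    light-combination : ∀ a → hammingWeight (combination r F a (G o F e)) ≤ (h + 2) + (h + 1) →
      (∀ j → a j ≡ false) ⊎ ∃[ j ] (∀ i → a i ≡ does (i Fin.≟ j))
    light-combination a light = at-most-one a
      (subst (_≤ 1) (total-allFin (δ ∘ a)) (ℕ.≮⇒≥ λ 2≤ → ℕ.<⇒≱ (heavy 2≤) light))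
      where
      open ℕ.≤-Reasoning
      open +-*-Solver
      heavy : 2 ≤ total (δ ∘ a) (allFin m) → (h + 2) + (h + 1) < hammingWeight (combination r F a (G o F e))
      heavy 2≤ = begin
        suc ((h + 2) + (h + 1))
          ≡⟨ solve 1 (λ h → con 1 :+ ((h :+ con 2) :+ (h :+ con 1)) := (h :+ con 2) :* con 2) refl h ⟩
        (h + 2) * 2
          ≤⟨ ℕ.*-monoʳ-≤ (h + 2) 2≤ ⟩
        (h + 2) * total (δ ∘ a) (allFin m)
          ≤⟨ hammingWeight-combination a ⟩
        hammingWeight (combination r F a (G o F e)) ∎

    -- The assumed weight is that of a row: too small for two rows and not 0, which leaves a single
    -- row.
    light-word : ∀ c → Member c → (k : Fin h) → hammingWeight c ≡ h + 3 + suc (toℕ k) →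
      ∃[ j ] (∀ i → nonzero (c i) ≡ meets o j (label o i))
    light-word c (a , c≗) k wt with light-combination a light
      where
      open ℕ.≤-Reasoning
      open +-*-Solver
      light : hammingWeight (combination r F a (G o F e)) ≤ (h + 2) + (h + 1)
      light = begin
        hammingWeight (combination r F a (G o F e)) ≡⟨ total-cong (λ i → cong (δ ∘ nonzero) (c≗ i)) (allFin N) ⟨
        hammingWeight c                             ≡⟨ wt ⟩
        -- An edge weight is at most `h`, so a row weighs at most `2 * h + 3`.
        h + 3 + suc (toℕ k)                         ≤⟨ ℕ.+-monoʳ-≤ (h + 3) (Fin.toℕ<n k) ⟩
        h + 3 + h                                   ≡⟨ solve 1 (λ h → h :+ con 3 :+ h := (h :+ con 2) :+ (h :+ con 1)) refl h ⟩
        (h + 2) + (h + 1)                           ∎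
    ... | inj₁ none = contradiction
      (trans (sym wt) (trans (total-cong zero-at (allFin N)) (total-zero (allFin N))))
      (λ p → ℕ.1+n≢0 (ℕ.m+n≡0⇒n≡0 (h + 3) p))
      where
      zero-at : ∀ i → δ (nonzero (c i)) ≡ 0
      zero-at i = cong δ (trans (cong nonzero (trans (c≗ i)
        (trans (combination-cong (G o F e) none i) (sum-replicate-zero m)))) nonzero-0#)
      total-zero : (xs : List X) → total (λ _ → 0) xs ≡ 0
      total-zero []       = refl
      total-zero (_ ∷ xs) = total-zero xs
    ... | inj₂ (j , a≗) = j , λ i → trans (cong nonzero (trans (c≗ i)
        (trans (combination-cong (G o F e) a≗ i) (combination-unit (G o F e) j i)))) (nonzero-G j i)

-- Recovering the vertices from the column supports

module _ {Γ : MultiGraph h n} {Γ′ : MultiGraph h n′} (o : EdgeOrdering Γ m) (o′ : EdgeOrdering Γ′ m′)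
         (φ : Permutation m m′) (π : Permutation (codeLength o′) (codeLength o))
         (weights : ∀ j → Edge.edgeWeight (EdgeOrdering.edge o′ (φ ⟨$⟩ʳ j)) ≡ Edge.edgeWeight (EdgeOrdering.edge o j))
         (supports : ∀ j i → meets o′ (φ ⟨$⟩ʳ j) (label o′ i) ≡ meets o j (label o (π ⟨$⟩ʳ i))) where

  private
    -- The support of a column, kept as a `Vec` so that columns with the same entries are
    -- propositionally equal and can be compared as members of a multiset.
    κ : Label o → Vec.Vec Bool m
    κ x = Vec.tabulate (λ j → meets o j x)

    -- The rows are read through `φ`, which makes these supports comparable with those of `κ`.
    κ′ : Label o′ → Vec.Vec Bool m
    κ′ x = Vec.tabulate (λ j → meets o′ (φ ⟨$⟩ʳ j) x)

  columnSupports : map κ′ (labels o′) ↭ map κ (labels o)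
  columnSupports = begin
    map κ′ (labels o′)                  ≡⟨ cong (map κ′) (tabulate-label o′) ⟨
    map κ′ (tabulate (label o′))        ≡⟨ List.map-tabulate (label o′) κ′ ⟩
    tabulate (κ′ ∘ label o′)            ≡⟨ List.tabulate-cong (λ i → Vec.tabulate-cong (λ j → supports j i)) ⟩
    tabulate (κ ∘ label o ∘ (π ⟨$⟩ʳ_))  ↭⟨ tabulate-permute (κ ∘ label o) π ⟨
    tabulate (κ ∘ label o)              ≡⟨ List.map-tabulate (label o) κ ⟨
    map κ (tabulate (label o))          ≡⟨ cong (map κ) (tabulate-label o) ⟩
    map κ (labels o)                    ∎
    where open PermutationReasoning

  blockSupports : map κ′ (map inj₁ (concatMap (E o′) (levels h))) ↭ map κ (map inj₁ (concatMap (E o) (levels h)))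
  blockSupports = begin
    map κ′ (map inj₁ (concatMap (E o′) (levels h)))
      ↭⟨ ↭.map⁺ κ′ (↭.map⁺ inj₁ (blocks-permute o o′ φ weights (levels h))) ⟩
    map κ′ (map inj₁ (map (φ ⟨$⟩ʳ_) bs))
      ≡⟨ trans (cong (map κ′) (sym (List.map-∘ bs))) (sym (List.map-∘ bs)) ⟩
    map (κ′ ∘ inj₁ ∘ (φ ⟨$⟩ʳ_)) bs
      ≡⟨ List.map-cong (λ l → Vec.tabulate-cong (λ j → does-≟-⟨$⟩ʳ φ j l)) bs ⟩
    map (κ ∘ inj₁) bs
      ≡⟨ List.map-∘ bs ⟩
    map κ (map inj₁ bs) ∎
    where
    open PermutationReasoning
    bs = concatMap (E o) (levels h)

  -- A vertex on exactly one edge has the same support as a column of a block D, so `π` need not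
  -- send columns of `A` to columns of `A`. Cancelling the blocks as multisets avoids the question.
  vertexSupports : tabulate (κ ∘ inj₂) ↭ tabulate (κ′ ∘ inj₂)
  vertexSupports = ++-cancelˡ-↭ (map κ (map inj₁ bs)) (begin
    map κ (map inj₁ bs) ++ tabulate (κ ∘ inj₂)
      ≡⟨ cong (map κ (map inj₁ bs) ++_) (trans (cong (map κ) (List.map-tabulate id inj₂)) (List.map-tabulate inj₂ κ)) ⟨
    map κ (map inj₁ bs) ++ map κ (map inj₂ (allFin n))
      ≡⟨ List.map-++ κ (map inj₁ bs) _ ⟨
    map κ (labels o)
      ↭⟨ columnSupports ⟨
    map κ′ (labels o′)
      ≡⟨ List.map-++ κ′ (map inj₁ bs′) _ ⟩
    map κ′ (map inj₁ bs′) ++ map κ′ (map inj₂ (allFin n′))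
      ↭⟨ ↭.++⁺ʳ _ blockSupports ⟩
    map κ (map inj₁ bs) ++ map κ′ (map inj₂ (allFin n′))
      ≡⟨ cong (map κ (map inj₁ bs) ++_) (trans (cong (map κ′) (List.map-tabulate id inj₂)) (List.map-tabulate inj₂ κ′)) ⟩
    map κ (map inj₁ bs) ++ tabulate (κ′ ∘ inj₂) ∎)
    where
    open PermutationReasoning
    bs = concatMap (E o) (levels h)
    bs′ = concatMap (E o′) (levels h)

  -- Several vertices may share a support, for instance isolated ones; any bijection `ψ` matching
  -- equal supports preserves incidence.
  supports⇒IncidenceIso : IncidenceIso o o′
  supports⇒IncidenceIso with ψ , matched ← ↭⇒permutation (κ ∘ inj₂) (κ′ ∘ inj₂) vertexSupports = record
    { edges      = φ
    ; vertices   = ψ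
    ; incidences = λ j v → begin
        meets o′ (φ ⟨$⟩ʳ j) (inj₂ (ψ ⟨$⟩ʳ v))             ≡⟨ Vec.lookup∘tabulate (λ j → meets o′ (φ ⟨$⟩ʳ j) (inj₂ (ψ ⟨$⟩ʳ v))) j ⟨
        Vec.lookup (κ′ (inj₂ (ψ ⟨$⟩ʳ v))) j          ≡⟨ cong (λ xs → Vec.lookup xs j) (matched v) ⟨
        Vec.lookup (κ (inj₂ v)) j                    ≡⟨ Vec.lookup∘tabulate (λ j → meets o j (inj₂ v)) j ⟩
        meets o j (inj₂ v)                           ∎
    ; weights    = weights
    }
    where open ≡-Reasoning

-- From an isomorphism to an equivalence of codes

module _ (r : ℕ) (F : FiniteField (2 ^ r)) {e : FiniteField.Carrier F}
         {Γ : MultiGraph h n} {Γ′ : MultiGraph h n′}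
         (o : EdgeOrdering Γ m) (o′ : EdgeOrdering Γ′ m′) where
  open FiniteField F using (Carrier; 0#; +-commutativeMonoid) renaming (_+_ to _⊕_)
  open Summation +-commutativeMonoid using (sum-cong-≗; sum-permute)
  open AdditiveCode using (Member; zero∈; +-closed)

  private
    N N′ : ℕ
    N  = codeLength o
    N′ = codeLength o′
    C  = rowSpan r F (G o F e)
    C′ = rowSpan r F (G o′ F e)

  module _ (I : IncidenceIso o o′) where
    open IncidenceIso I

    labels-permute : labels o′ ↭ map (Sum.map (edges ⟨$⟩ʳ_) (vertices ⟨$⟩ʳ_)) (labels o)
    labels-permute = begin
      map inj₁ (concatMap (E o′) (levels h)) ++ map inj₂ (allFin n′)
        ↭⟨ ↭.++⁺ (↭.map⁺ inj₁ (blocks-permute o o′ edges weights (levels h)))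
                 (↭.map⁺ inj₂ (allFin-permute vertices)) ⟩
      map inj₁ (map (edges ⟨$⟩ʳ_) bs) ++ map inj₂ (map (vertices ⟨$⟩ʳ_) (allFin n))
        ≡⟨ cong₂ _++_ (trans (sym (List.map-∘ bs)) (List.map-∘ bs))
                      (trans (sym (List.map-∘ (allFin n))) (List.map-∘ (allFin n))) ⟩
      map f (map inj₁ bs) ++ map f (map inj₂ (allFin n))
        ≡⟨ List.map-++ f (map inj₁ bs) _ ⟨
      map f (labels o) ∎
      where
      open PermutationReasoning
      f = Sum.map (edges ⟨$⟩ʳ_) (vertices ⟨$⟩ʳ_)
      bs = concatMap (E o) (levels h)

    columnPermutation : ∃[ π ] (∀ i → label o′ i ≡ Sum.map (edges ⟨$⟩ʳ_) (vertices ⟨$⟩ʳ_) (label o (π ⟨$⟩ʳ i)))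
    columnPermutation = ↭⇒permutation (label o′) (Sum.map (edges ⟨$⟩ʳ_) (vertices ⟨$⟩ʳ_) ∘ label o)
      (begin
        tabulate (label o′)     ≡⟨ tabulate-label o′ ⟩
        labels o′               ↭⟨ labels-permute ⟩
        map f (labels o)        ≡⟨ cong (map f) (tabulate-label o) ⟨
        map f (tabulate (label o)) ≡⟨ List.map-tabulate (label o) f ⟩
        tabulate (f ∘ label o)  ∎)
      where
      open PermutationReasoning
      f = Sum.map (edges ⟨$⟩ʳ_) (vertices ⟨$⟩ʳ_)

    meets-permute : ∀ j x → meets o′ (edges ⟨$⟩ʳ j) (Sum.map (edges ⟨$⟩ʳ_) (vertices ⟨$⟩ʳ_) x) ≡ meets o j x
    meets-permute j (inj₂ v) = incidences j v
    meets-permute j (inj₁ l) = does-≟-⟨$⟩ʳ edges j l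

    -- An entry depends only on whether the row meets the column and on the edge weight, and both
    -- are preserved.
    G-permute : ∀ j i → G o′ F e (edges ⟨$⟩ʳ j) i ≡ G o F e j (proj₁ columnPermutation ⟨$⟩ʳ i)
    G-permute j i = begin
      G o′ F e (edges ⟨$⟩ʳ j) i
        ≡⟨ G-entry o′ F e (edges ⟨$⟩ʳ j) i ⟩
      incidenceEntry o′ F e (edges ⟨$⟩ʳ j) (label o′ i)
        ≡⟨ cong₂ (λ b w → if b then e ^ᶠ (w ∸ 1) else 0#)
             (trans (cong (meets o′ (edges ⟨$⟩ʳ j)) (proj₂ columnPermutation i)) (meets-permute j (label o (proj₁ columnPermutation ⟨$⟩ʳ i)))) (weights j) ⟩
      incidenceEntry o F e j (label o (proj₁ columnPermutation ⟨$⟩ʳ i))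
        ≡⟨ G-entry o F e j _ ⟨
      G o F e j (proj₁ columnPermutation ⟨$⟩ʳ i) ∎
      where
      open ≡-Reasoning
      open FiniteField F using () renaming (_^_ to _^ᶠ_)

    combination-permute : ∀ a i → combination r F a (G o′ F e) i ≡
      combination r F (a ∘ (edges ⟨$⟩ʳ_)) (G o F e) (proj₁ columnPermutation ⟨$⟩ʳ i)
    combination-permute a i = trans
      (sum-permute (λ j → if a j then G o′ F e j i else 0#) edges)
      (sum-cong-≗ (λ j → cong (λ x → if a (edges ⟨$⟩ʳ j) then x else 0#) (G-permute j i)))

    IncidenceIso⇒Equivalent : Equivalent r F C C′
    IncidenceIso⇒Equivalent = record
      { sameLength = sym (Perm.↔⇒≡ π)
      ; π          = π
      -- The matrices agree entry by entry after permuting rows and columns, so the symbols stay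
      -- fixed.
      ; σ          = λ _ → ↔-refl
      ; image      = λ c′ → mk⇔
          (λ (a , c′≗) → combination r F (a ∘ (edges ⟨$⟩ʳ_)) (G o F e) , (_ , λ _ → refl) ,
            λ i → trans (c′≗ i) (combination-permute a i))
          (λ (c , (a , c≗) , c′≗) → a ∘ (edges ⟨$⟩ˡ_) , λ i → begin
            c′ i
              ≡⟨ c′≗ i ⟩
            c (π ⟨$⟩ʳ i)
              ≡⟨ c≗ (π ⟨$⟩ʳ i) ⟩
            combination r F a (G o F e) (π ⟨$⟩ʳ i)
              ≡⟨ combination-cong r F (G o F e) (λ _ → cong a (sym (Perm.inverseˡ edges))) (π ⟨$⟩ʳ i) ⟩
            combination r F (a ∘ (edges ⟨$⟩ˡ_) ∘ (edges ⟨$⟩ʳ_)) (G o F e) (π ⟨$⟩ʳ i)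
              ≡⟨ combination-permute (a ∘ (edges ⟨$⟩ˡ_)) i ⟨
            combination r F (a ∘ (edges ⟨$⟩ˡ_)) (G o′ F e) i ∎)
      }
      where
      open ≡-Reasoning
      π = proj₁ columnPermutation

  -- From an equivalence of codes to an incidence isomorphism

  module _ (e≢0 : e ≢ 0#) (eq : Equivalent r F C C′) where
    open Equivalent eq

    private
      edge  = EdgeOrdering.edge o
      edge′ = EdgeOrdering.edge o′

      support : Fin m → Fin N → Bool
      support j = meets o j ∘ label o

      support′ : Fin m′ → Fin N′ → Bool
      support′ j = meets o′ j ∘ label o′

    total-π : (f : Fin N → ℕ) → total (f ∘ (π ⟨$⟩ʳ_)) (allFin N′) ≡ total f (allFin N)
    total-π f = trans (sym (total-map f (π ⟨$⟩ʳ_) (allFin N′))) (sym (total-↭ f (allFin-permute π)))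

    image-0 : Fin N′ → Carrier
    image-0 i = Inverse.to (σ i) 0#

    -- Each `σ i` is an arbitrary bijection, so this word may be nonzero; its membership keeps
    -- translates by it inside `C′`.
    image-0∈C′ : Member C′ image-0
    image-0∈C′ = Equivalence.from (image image-0) ((λ _ → 0#) , zero∈ C , λ _ → refl)

    -- Translating by the image of the zero word makes the equivalence preserve
    -- supports, hence weights.
    row⇒row′ : ∀ j → ∃[ j′ ] (∀ i → support′ j′ i ≡ support j (π ⟨$⟩ʳ i))
    row⇒row′ j = proj₁ found , λ i → trans (sym (proj₂ found i)) (same i)
      where
      c′ : Fin N′ → Carrier
      c′ i = Inverse.to (σ i) (G o F e j (π ⟨$⟩ʳ i)) ⊕ image-0 i
      c′∈C′ : Member C′ c′
      c′∈C′ = +-closed C′ (Equivalence.from (image _) (G o F e j , row∈rowSpan r F (G o F e) j , λ _ → refl)) image-0∈C′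
      same : ∀ i → nonzero r F (c′ i) ≡ support j (π ⟨$⟩ʳ i)
      same i = trans (nonzero-translate r F (σ i) (G o F e j (π ⟨$⟩ʳ i))) (nonzero-G r F e≢0 o j (π ⟨$⟩ʳ i))
      found = light-word r F e≢0 o′ c′ c′∈C′ (Edge.k (edge j))
        (trans (total-cong (cong δ ∘ same) (allFin N′)) (trans (total-π (δ ∘ support j)) (support-weight o j)))

    -- Here the translation comes before pulling back: the row plus `image-0` has a preimage `c`,
    -- and adding `image-0` a second time restores the row, so `c` has the support of the row.
    row′⇒row : ∀ j′ → ∃[ j ] (∀ i → support′ j′ i ≡ support j (π ⟨$⟩ʳ i))
    row′⇒row j′ = proj₁ found , λ i → trans (sym (same i)) (proj₂ found (π ⟨$⟩ʳ i))
      where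
      preimage = Equivalence.to (image (λ i → G o′ F e j′ i ⊕ image-0 i))
        (+-closed C′ (row∈rowSpan r F (G o′ F e) j′) image-0∈C′)
      c = proj₁ preimage
      same : ∀ i → nonzero r F (c (π ⟨$⟩ʳ i)) ≡ support′ j′ i
      same i = begin
        nonzero r F (c (π ⟨$⟩ʳ i))                                     ≡⟨ nonzero-translate r F (σ i) (c (π ⟨$⟩ʳ i)) ⟨
        nonzero r F (Inverse.to (σ i) (c (π ⟨$⟩ʳ i)) ⊕ image-0 i)      ≡⟨ cong (λ x → nonzero r F (x ⊕ image-0 i)) (proj₂ (proj₂ preimage) i) ⟨
        nonzero r F ((G o′ F e j′ i ⊕ image-0 i) ⊕ image-0 i)          ≡⟨ cong (nonzero r F) (x+y+y≡x r F (G o′ F e j′ i) (image-0 i)) ⟩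
        nonzero r F (G o′ F e j′ i)                                    ≡⟨ nonzero-G r F e≢0 o′ j′ i ⟩
        support′ j′ i                                                ∎
        where open ≡-Reasoning
      found = light-word r F e≢0 o c (proj₁ (proj₂ preimage)) (Edge.k (edge′ j′))
        (trans (sym (total-π (δ ∘ nonzero r F ∘ c)))
          (trans (total-cong (cong δ ∘ same) (allFin N′)) (support-weight o′ j′)))

    -- Both maps preserve supports along `π`, and a support determines its row, so the two
    -- composites are identities.
    rowPermutation : Permutation m m′
    rowPermutation = permutation (proj₁ ∘ row⇒row′) (proj₁ ∘ row′⇒row)
      (λ j′ → support-injective o′ λ i →
        trans (proj₂ (row⇒row′ (proj₁ (row′⇒row j′))) i) (sym (proj₂ (row′⇒row j′) i)))
      (λ j → support-injective o λ c →
        -- The supports are known to agree at the columns `π ⟨$⟩ʳ i`; every column `c` is of this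
        -- form.
        subst (λ c → support (proj₁ (row′⇒row (proj₁ (row⇒row′ j)))) c ≡ support j c) (Perm.inverseʳ π)
          (trans (sym (proj₂ (row′⇒row (proj₁ (row⇒row′ j))) (π ⟨$⟩ˡ c))) (proj₂ (row⇒row′ j) (π ⟨$⟩ˡ c))))

    private
      φ : Fin m → Fin m′
      φ = rowPermutation ⟨$⟩ʳ_

    -- The edge weight can be read off from the size of the support, which a permutation of the
    -- columns leaves unchanged.
    rowPermutation-weights : ∀ j → Edge.edgeWeight (edge′ (φ j)) ≡ Edge.edgeWeight (edge j)
    rowPermutation-weights j = ℕ.+-cancelˡ-≡ (h + 3) _ _ (begin
      h + 3 + Edge.edgeWeight (edge′ (φ j))                  ≡⟨ support-weight o′ (φ j) ⟨
      total (δ ∘ support′ (φ j)) (allFin N′)                 ≡⟨ total-cong (cong δ ∘ proj₂ (row⇒row′ j)) (allFin N′) ⟩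
      total (δ ∘ support j ∘ (π ⟨$⟩ʳ_)) (allFin N′)          ≡⟨ total-π (δ ∘ support j) ⟩
      total (δ ∘ support j) (allFin N)                       ≡⟨ support-weight o j ⟩
      h + 3 + Edge.edgeWeight (edge j)                       ∎)
      where open ≡-Reasoning

    Equivalent⇒IncidenceIso : IncidenceIso o o′
    Equivalent⇒IncidenceIso = supports⇒IncidenceIso o o′ rowPermutation π rowPermutation-weights (proj₂ ∘ row⇒row′)

theorem1 : (h r : ℕ) → 1 ≤ h → 1 ≤ r → h < 2 ^ r →
    (F : FiniteField (2 ^ r)) (e : FiniteField.Carrier F) → FiniteField.IsPrimitive F e →
    (n n′ : ℕ) (Γ : MultiGraph h n) (Γ′ : MultiGraph h n′) →
    2 * h ≤ n * (n ∸ 1) → 2 * h ≤ n′ * (n′ ∸ 1) →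
    (m m′ : ℕ) (o : EdgeOrdering Γ m) (o′ : EdgeOrdering Γ′ m′) →
    Γ ≅ Γ′ ⇔ Equivalent r F (rowSpan r F (G o F e)) (rowSpan r F (G o′ F e))
theorem1 h r _ _ _ F e (e≢0 , _) n n′ Γ Γ′ _ _ m m′ o o′ = mk⇔
  (λ iso → IncidenceIso⇒Equivalent r F o o′ (≅⇒IncidenceIso iso))
  (λ eq → IncidenceIso⇒≅ (Equivalent⇒IncidenceIso r F o o′ e≢0 eq))
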